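{- Let $n\ge3$ and $d\ge2$. The order of $\mathbb{T}_n^d$ equals $|\mathbb{R}_d|\cdot|\mathbb{F}_n|$.
   Context: Let $[n]=\{0,\dots,n-1\}$; the cube $n^d$ is $[n]^d$. A set of $n$ distinct points is a line if it can be ordered $(q^1,\dots,q^n)$ such that in each coordinate the sequence of values is strictly increasing, strictly decreasing or constant, with at least one coordinate non-constant. $\mathbb{T}_n^d$ is the group of permutations of $[n]^d$ mapping lines onto lines. $\mathbb{R}_d$ is the group generated by the maps $R_{ij}$ ($i\ne j$), where $R_{ij}([x_1,\dots,x_d])$ has $i$-th coordinate $n-x_j-1$, $j$-th coordinate $x_i$, and other coordinates unchanged. $\mathbb{F}_n$ is the group of maps $F_\pi([x_1,\dots,x_d])=[\pi(x_1),\dots,\pi(x_d)]$ for permutations $\pi$ of $[n]$ with $\pi(n-p-1)=n-\pi(p)-1$ for all $p$. -}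

module Defs where

open import Data.Nat using (ℕ; _*_)
open import Data.Fin using (Fin; opposite) renaming (_<_ to _<ᶠ_)
open import Data.Vec using (Vec; lookup; map; _[_]≔_)
open import Data.Product using (Σ; _×_; ∃; ∃-syntax)
open import Relation.Binary.PropositionalEquality using (_≡_; _≢_; _≗_)
open import Relation.Nullary using (¬_)
open import Function using (_∘_; id; _⇔_)
open import Function.Definitions using (Bijective)

Point : ℕ → ℕ → Set
Point n d = Vec (Fin n) d

Map : ℕ → ℕ → Set
Map n d = Point n d → Point n d

StrictlyIncreasing : ∀ {n} → (Fin n → Fin n) → Set
StrictlyIncreasing a = ∀ j k → j <ᶠ k → a j <ᶠ a k

StrictlyDecreasing : ∀ {n} → (Fin n → Fin n) → Set
StrictlyDecreasing a = ∀ j k → j <ᶠ k → a k <ᶠ a j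

Constant : ∀ {n} → (Fin n → Fin n) → Set
Constant a = ∀ j k → a j ≡ a k

-- An ordering (q¹,…,qⁿ) of n points witnessing that its underlying set is a line:
-- the points are distinct, every coordinate is strictly increasing, strictly
-- decreasing or constant, and at least one coordinate is non-constant.
IsLineOrdering : ∀ {n d} → (Fin n → Point n d) → Set
IsLineOrdering {n} {d} q =
  (∀ j k → q j ≡ q k → j ≡ k)
  × (∀ (i : Fin d) → let a = λ j → lookup (q j) i in
       (StrictlyIncreasing a ⊎′ StrictlyDecreasing a) ⊎′ Constant a)
  × (∃[ i ] ¬ Constant (λ j → lookup (q j) i))
  where
  open import Data.Sum using () renaming (_⊎_ to _⊎′_)

MapsLinesToLines : ∀ {n d} → Map n d → Set
MapsLinesToLines {n} {d} σ =
  ∀ (q : Fin n → Point n d) → IsLineOrdering q →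
    ∃[ q′ ] (IsLineOrdering q′ ×
             (∀ p → (∃[ j ] σ (q j) ≡ p) ⇔ (∃[ j ] q′ j ≡ p)))

InT : ∀ n d → Map n d → Set
InT n d σ = Bijective _≡_ _≡_ σ × MapsLinesToLines σ

R : ∀ {n d} → Fin d → Fin d → Map n d
R i j x = (x [ i ]≔ opposite (lookup x j)) [ j ]≔ lookup x i

-- Membership in ℝ_d = ⟨ R_ij : i ≠ j ⟩ (acting on [n]^d).
-- Since R_ij⁻¹ = R_ji, the generated group equals the set of finite
-- compositions of generators.
data InR (n d : ℕ) : Map n d → Set where
  R-id   : InR n d id
  R-step : ∀ (i j : Fin d) → i ≢ j → ∀ g → InR n d g → InR n d (R i j ∘ g)

InF : ∀ n d → Map n d → Set
InF n d σ =
  ∃[ π ] (Bijective _≡_ _≡_ π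
          × (∀ p → π (opposite p) ≡ opposite (π p))
          × σ ≗ map π)

HasSize : ∀ {n d} → (Map n d → Set) → ℕ → Set
HasSize {n} {d} P k =
  Σ (Fin k → Map n d) λ f →
      (∀ i → P (f i))
    × (∀ i j → f i ≗ f j → i ≡ j)
    × (∀ σ → P σ → ∃[ i ] f i ≗ σ)

{-# OPTIONS --safe #-}
module Submission where

-- A line is a choice, in every coordinate, of a constant, the identity or the reflection
-- v ↦ n − 1 − v. Call a point x of a line ℓ rich if another line through x can be matched
-- with ℓ, point by point, so that matched points are collinear. Unless ℓ is parallel to an axis i and no other
-- coordinate of x agrees with the i-th one up to reflection, x is rich on ℓ; in that case it
-- is not. Richness is preserved by line-preserving permutations (the inverse of such a σ is an
-- iterate of σ). Hence so is the relation "x and y are the only two rich points of a line",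
-- which says that x and y are adjacent vertices of a cube {v, n − 1 − v}^d. This makes σ a
-- cube isomorphism on corners, up to a signed coordinate permutation; collinearity with the
-- corners then shows that σ applies one symmetric permutation of [n] to every coordinate.
--
-- So the line-preserving permutations are the composites of a signed coordinate permutation
-- and an F_π, uniquely once the sign of coordinate 0 is required to be positive. The signed
-- permutations with that normalisation also count ℝ_d, since a rotation is a signed
-- permutation of determinant 1, and the determinant recovers the sign of coordinate 0.
-- (For even d the groups ℝ_d and 𝔽_n meet in the central reflection, so the orders multiply
-- although ℝ_d and 𝔽_n do not generate the whole group.)

open import Defs
open import Data.Bool using (Bool; _xor_; _∧_; false; if_then_else_; not; true)
open import Data.Bool.Properties using (not-distribʳ-xor; xor-assoc; xor-comm; xor-identityʳ; ∧-identityʳ; ∧-zeroʳ) renaming (_≟_ to _≟ᵇ_)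
open import Data.Bool.Solver using (module xor-∧-Solver)
open import Data.Empty using (⊥)
open import Data.Fin using (Fin; combine; finToFun; fromℕ<; funToFin; opposite; punchOut; remQuot; suc; toℕ; zero) renaming (_<_ to _<ᶠ_)
open import Data.Fin.Properties using (_≟_; all?; any?; combine-remQuot; finToFun-funToFin; fromℕ<-toℕ; funToFin-finToFin; injective⇒≤; opposite-involutive; opposite-prop; pigeonhole; punchOut-injective; remQuot-combine; suc-injective; toℕ-fromℕ<; toℕ-injective; toℕ<n)
open import Data.Nat using (_*_; _+_; _<_; _^_; _∸_; _≤_; suc; s≤s; zero; z≤n; ℕ)
open import Data.Nat.Properties using (+-comm; +-mono-≤-<; +-suc; 1+n≰n; <-cmp; <-irrefl; <-trans; <⇒≤; _<?_; m∸n+n≡m; m≤n⇒m<n∨m≡n; n<1+n; ∸-monoʳ-<; ≤-<-trans; ≤-antisym; ≤-refl; ≤-trans; ≮⇒≥)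
open import Data.Product using (_,_; _×_; proj₁; proj₂; Σ-syntax; ∃; ∃-syntax; ∃₂)
open import Data.Sum using ([_,_]′; _⊎_; inj₁; inj₂)
open import Data.Unit using (⊤)
open import Data.Vec using (_[_]≔_; lookup; map; tabulate)
open import Data.Vec.Functional using (updateAt)
open import Data.Vec.Functional.Properties using (updateAt-minimal; updateAt-updates)
open import Data.Vec.Properties using (lookup-map; lookup∘tabulate; lookup∘update; lookup∘update′; map-cong; tabulate-cong; tabulate∘lookup)
open import Function using (Equivalence; _∘_; const; id; mk⇔)
open import Relation.Binary.Definitions using (tri<; tri>; tri≈)
open import Relation.Binary.PropositionalEquality using (_≗_; _≡_; _≢_; cong; cong₂; module ≡-Reasoning; refl; subst; subst₂; sym; trans)
open import Relation.Nullary using (Dec; contradiction; no; yes; ¬_)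
open import Relation.Nullary.Decidable using (_×-dec_; _→-dec_; _⊎-dec_; dec-false; dec-true; does; map′; ¬?)

variable
  n d k : ℕ
  A B : Set

-- Injections and counting on finite sets

Inj : (A → B) → Set
Inj f = ∀ {x y} → f x ≡ f y → x ≡ y

abstract
  Inj⇒surjective : (f : Fin n → Fin n) → Inj f → ∀ y → ∃[ x ] f x ≡ y
  Inj⇒surjective {suc n} f f-inj y with any? (λ x → f x ≟ y)
  ... | yes hit = hit
  ... | no miss = contradiction (injective⇒≤ {f = avoid} avoid-inj) 1+n≰n
    where
    y≢f : ∀ x → y ≢ f x
    y≢f x y≡fx = miss (x , sym y≡fx)
    avoid : Fin (suc n) → Fin n
    avoid x = punchOut (y≢f x)
    avoid-inj : Inj avoid
    avoid-inj {x} {x′} = f-inj ∘ punchOut-injective (y≢f x) (y≢f x′)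

all⊎some : {P Q : Fin k → Set} → (∀ i → P i ⊎ Q i) → (∀ i → P i) ⊎ ∃ Q
all⊎some {zero} f = inj₁ λ ()
all⊎some {suc k} f with f zero | all⊎some (f ∘ suc)
... | inj₂ q | _ = inj₂ (zero , q)
... | inj₁ p | inj₂ (i , q) = inj₂ (suc i , q)
... | inj₁ p | inj₁ ps = inj₁ λ { zero → p ; (suc i) → ps i }

abstract
  -- Opaque, since case splits on it use only a witness or its absence, never the way the search
  -- runs.
  some? : {P : Fin k → Set} → (∀ i → Dec (P i)) → Dec (∃ P)
  some? = any?

third : (a b : Fin (suc (suc (suc n)))) → ∃[ c ] c ≢ a × c ≢ b
third zero zero = suc zero , (λ ()) , (λ ())
third zero (suc zero) = suc (suc zero) , (λ ()) , (λ ())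
third zero (suc (suc b)) = suc zero , (λ ()) , (λ ())
third (suc zero) zero = suc (suc zero) , (λ ()) , (λ ())
third (suc (suc a)) zero = suc zero , (λ ()) , (λ ())
third (suc a) (suc b) = zero , (λ ()) , (λ ())

count : (Fin k → Bool) → ℕ
count {zero} f = 0
count {suc k} f with f zero
... | true = suc (count (f ∘ suc))
... | false = count (f ∘ suc)

count-mono : {f g : Fin k → Bool} → (∀ i → f i ≡ true → g i ≡ true) → count f ≤ count g
count-mono {zero} f⇒g = z≤n
count-mono {suc k} {f} {g} f⇒g with f zero in f₀ | g zero in g₀
... | true | true = s≤s (count-mono (f⇒g ∘ suc))
... | true | false = contradiction (trans (sym g₀) (f⇒g zero f₀)) λ ()
... | false | true = ≤-trans (count-mono (f⇒g ∘ suc)) (<⇒≤ (n<1+n _))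
... | false | false = count-mono (f⇒g ∘ suc)

count-strict : {f g : Fin k → Bool} → (∀ i → f i ≡ true → g i ≡ true) →
  ∀ i → g i ≡ true → f i ≡ false → count f < count g
count-strict {suc k} {f} {g} f⇒g zero gᵢ fᵢ rewrite gᵢ | fᵢ = s≤s (count-mono (f⇒g ∘ suc))
count-strict {suc k} {f} {g} f⇒g (suc i) gᵢ fᵢ with f zero in f₀ | g zero in g₀
... | true | true = s≤s (count-strict (f⇒g ∘ suc) i gᵢ fᵢ)
... | true | false = contradiction (trans (sym g₀) (f⇒g zero f₀)) λ ()
... | false | true = <-trans (count-strict (f⇒g ∘ suc) i gᵢ fᵢ) (n<1+n _)
... | false | false = count-strict (f⇒g ∘ suc) i gᵢ fᵢ

-- Reflections of a coordinate

flip : Bool → Fin n → Fin n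
flip false = id
flip true = opposite

flip-involutive : ∀ b (v : Fin n) → flip b (flip b v) ≡ v
flip-involutive false v = refl
flip-involutive true v = opposite-involutive v

flip-injective : ∀ b → Inj (flip {n} b)
flip-injective b {x} {y} eq =
  trans (sym (flip-involutive b x)) (trans (cong (flip b) eq) (flip-involutive b y))

flip-xor : ∀ b c (v : Fin n) → flip b (flip c v) ≡ flip (b xor c) v
flip-xor false c v = refl
flip-xor true false v = refl
flip-xor true true v = opposite-involutive v

flip-not : ∀ b (v : Fin n) → flip (not b) v ≡ opposite (flip b v)
flip-not false v = refl
flip-not true v = sym (opposite-involutive v)

flip-swap : ∀ b {v w : Fin n} → v ≡ flip b w → w ≡ flip b v
flip-swap b {w = w} refl = sym (flip-involutive b w)

-- A fixed value satisfies v + (v + 1) = n, so it can only be the centre of [n].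
opposite-fixed-unique : {v w : Fin n} → opposite v ≡ v → opposite w ≡ w → v ≡ w
opposite-fixed-unique {n} {v} {w} v-fix w-fix = toℕ-injective (double-injective _ _ (trans (double v v-fix) (sym (double w w-fix))))
  where
  double : (x : Fin n) → opposite x ≡ x → toℕ x + suc (toℕ x) ≡ n
  double x x-fix = trans
    (cong (_+ suc (toℕ x)) (trans (cong toℕ (sym x-fix)) (opposite-prop x)))
    (m∸n+n≡m (toℕ<n x))
  double-injective : ∀ a b → a + suc a ≡ b + suc b → a ≡ b
  double-injective a b eq with <-cmp a b
  ... | tri≈ _ a≡b _ = a≡b
  ... | tri< a<b _ _ = contradiction (+-mono-≤-< (<⇒≤ a<b) (s≤s a<b)) (<-irrefl eq)
  ... | tri> _ _ b<a = contradiction (+-mono-≤-< (<⇒≤ b<a) (s≤s b<a)) (<-irrefl (sym eq))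

opposite-antitone : {v w : Fin n} → v <ᶠ w → opposite w <ᶠ opposite v
opposite-antitone {n} {v} {w} v<w =
  subst₂ _<_ (sym (opposite-prop w)) (sym (opposite-prop v)) (∸-monoʳ-< (s≤s v<w) (toℕ<n w))

zero≢opposite : (zero {suc n}) ≢ opposite zero
zero≢opposite ()

-- Points

_!_ : Point n d → Fin d → Fin n
_!_ = lookup

infixl 20 _!_

abstract
  -- Opaque, so that coordinates of a constructed point are read only through `pt-!`.
  pt : (Fin d → Fin n) → Point n d
  pt = tabulate

  pt-! : (f : Fin d → Fin n) → ∀ i → pt f ! i ≡ f i
  pt-! = lookup∘tabulate

point-ext : {x y : Point n d} → (∀ i → x ! i ≡ y ! i) → x ≡ y
point-ext {x = x} {y} eq =
  trans (sym (tabulate∘lookup x)) (trans (tabulate-cong eq) (tabulate∘lookup y))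

-- Finiteness of the cube and iterates of a permutation

encode : Point n d → Fin (n ^ d)
encode x = funToFin (lookup x)

decode : Fin (n ^ d) → Point n d
decode c = tabulate (finToFun c)

funToFin-cong : {f g : Fin k → Fin n} → f ≗ g → funToFin f ≡ funToFin g
funToFin-cong {zero} eq = refl
funToFin-cong {suc k} eq = cong₂ combine (eq zero) (funToFin-cong (eq ∘ suc))

decode-encode : (x : Point n d) → decode (encode x) ≡ x
decode-encode x = trans (tabulate-cong (finToFun-funToFin (lookup x))) (tabulate∘lookup x)

encode-decode : (c : Fin (n ^ d)) → encode {n} {d} (decode c) ≡ c
encode-decode {n} {d} c = trans (funToFin-cong {d} {n} (lookup∘tabulate (finToFun c))) (funToFin-finToFin {d} {n} c)

encode-injective : Inj (encode {n} {d})
encode-injective {x = x} {y} eq = trans (sym (decode-encode x)) (trans (cong decode eq) (decode-encode y))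

Inj⇒surjective-Map : (σ : Map n d) → Inj σ → ∀ y → ∃[ x ] σ x ≡ y
Inj⇒surjective-Map {n} {d} σ σ-inj y =
  let c , eq = Inj⇒surjective σᶜ σᶜ-inj (encode y) in decode c , encode-injective eq
  where
  σᶜ : Fin (n ^ d) → Fin (n ^ d)
  σᶜ c = encode (σ (decode c))
  σᶜ-inj : Inj σᶜ
  σᶜ-inj {c} {c′} eq = trans (sym (encode-decode {n} {d} c))
    (trans (cong encode (σ-inj (encode-injective eq))) (encode-decode {n} {d} c′))

iterate : ℕ → Map n d → Map n d
iterate zero σ = id
iterate (suc j) σ = iterate j σ ∘ σ

iterate-injective : ∀ j {σ : Map n d} → Inj σ → Inj (iterate j σ)
iterate-injective zero σ-inj = id
iterate-injective (suc j) σ-inj = σ-inj ∘ iterate-injective j σ-inj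

iterate-suc : ∀ j (σ : Map n d) x → iterate (suc j) σ x ≡ σ (iterate j σ x)
iterate-suc zero σ x = refl
iterate-suc (suc j) σ x = iterate-suc j σ (σ x)

iterate-+ : ∀ i j (σ : Map n d) x → iterate (i + j) σ x ≡ iterate i σ (iterate j σ x)
iterate-+ zero j σ x = refl
iterate-+ (suc i) j σ x = trans (iterate-+ i j σ (σ x)) (cong (iterate i σ) (iterate-suc j σ x))

encode-Map : Map n d → Fin ((n ^ d) ^ (n ^ d))
encode-Map σ = funToFin (encode ∘ σ ∘ decode)

encode-Map-injective : (σ τ : Map n d) → encode-Map σ ≡ encode-Map τ → σ ≗ τ
encode-Map-injective {n} {d} σ τ eq x =
  subst (λ y → σ y ≡ τ y) (decode-encode x) (encode-injective (trans (sym (finToFun-funToFin _ (encode x)))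
    (trans (cong (λ c → finToFun c (encode x)) eq) (finToFun-funToFin _ (encode x)))))

-- There are finitely many maps, so two iterates of σ coincide, say the i-th and the j-th with i <
-- j. Cancelling the i-th iterate shows that the iterate of order j - i - 1 undoes σ. This makes the
-- inverse line-preserving without any separate hypothesis on it.
inverse-is-iterate : (σ : Map n d) → Inj σ → ∃[ j ] (∀ x → iterate j σ (σ x) ≡ x)
inverse-is-iterate {n} {d} σ σ-inj with pigeonhole (n<1+n _) (λ i → encode-Map (iterate (toℕ i) σ))
... | i , j , i<j , eq = toℕ j ∸ suc (toℕ i) , λ x →
  iterate-injective (toℕ i) σ-inj (trans (sym (iterate-+ (toℕ i) _ σ (σ x)))
    (trans (cong (λ m → iterate m σ x) arith) (sym (encode-Map-injective (iterate (toℕ i) σ) (iterate (toℕ j) σ) eq x))))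
  where
  arith : suc (toℕ i + (toℕ j ∸ suc (toℕ i))) ≡ toℕ j
  arith = trans (cong suc (+-comm (toℕ i) _)) (trans (sym (+-suc _ (toℕ i))) (m∸n+n≡m i<j))

-- Lines

data Dir (n : ℕ) : Set where
  fix : Fin n → Dir n
  run : Bool → Dir n

at : Dir n → Fin n → Fin n
at (fix c) v = c
at (run b) v = flip b v

Code : ℕ → ℕ → Set
Code n d = Fin d → Dir n

Moves : Code n d → Set
Moves L = ∃₂ λ i b → L i ≡ run b

ev : Code n d → Fin n → Point n d
ev L v = pt λ i → at (L i) v

ev-! : (L : Code n d) → ∀ v i → ev L v ! i ≡ at (L i) v
ev-! L v = pt-! _

at-run : {D : Dir n} → ∀ {b} → D ≡ run b → Inj (at D)
at-run {b = b} refl = flip-injective b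

Reads : (Fin n → Point n d) → Code n d → (Fin n → Fin n) → Set
Reads q L θ = ∀ j i → q j ! i ≡ at (L i) (θ j)

-- The injection `θ` lets `q` list the points of the line in any order, as is inevitable for
-- `σ ∘ q`.
IsLine : (Fin n → Point n d) → Set
IsLine q = ∃[ L ] Moves L × ∃[ θ ] Inj θ × Reads q L θ

ev-isLine : (L : Code n d) → Moves L → IsLine (ev L)
ev-isLine L mv = L , mv , id , id , ev-! L

IsLine-injective : {q : Fin n → Point n d} → IsLine q → Inj q
IsLine-injective (L , (i , b , Lᵢ) , θ , θ-inj , q≡) {j} {k} eq =
  θ-inj (at-run Lᵢ (trans (sym (q≡ j i)) (trans (cong (_! i) eq) (q≡ k i))))

flip-compare : ∀ e r f → (∀ (v : Fin n) → flip e (flip r v) ≡ flip f v) ⊎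
                         (∀ (v : Fin n) → flip e (flip r v) ≡ opposite (flip f v))
flip-compare false false false = inj₁ λ v → refl
flip-compare false false true = inj₂ λ v → sym (opposite-involutive v)
flip-compare false true false = inj₂ λ v → refl
flip-compare false true true = inj₁ λ v → refl
flip-compare true false false = inj₂ λ v → refl
flip-compare true false true = inj₁ λ v → refl
flip-compare true true false = inj₁ λ v → opposite-involutive v
flip-compare true true true = inj₂ λ v → refl

-- If two coordinates ran with different relative orientations, the common points
-- of the two lines would both sit at the centre of [n].
line-unique : {L M : Code n d} → Moves L → ∀ {a a′ b b′} → a ≢ a′ →
  (∀ i → at (L i) a ≡ at (M i) b) → (∀ i → at (L i) a′ ≡ at (M i) b′) →
  ∀ v → ∃[ w ] (∀ i → at (L i) v ≡ at (M i) w)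
line-unique {n} {d} {L} {M} (i₀ , b₀ , L₀) {a} {a′} {b} {b′} a≢a′ p p′ v = go (M i₀) refl
  where
  b≢b′ : b ≢ b′
  b≢b′ refl = a≢a′ (at-run L₀ (trans (p i₀) (sym (p′ i₀))))
  go : ∀ D → M i₀ ≡ D → ∃[ w ] (∀ i → at (L i) v ≡ at (M i) w)
  go (fix c) M₀ = contradiction
    (at-run L₀ (trans (p i₀) (trans (subst (λ D → at D b ≡ at D b′) (sym M₀) refl) (sym (p′ i₀))))) a≢a′
  go (run c₀) M₀ = flip r v , same
    where
    r : Bool
    r = b₀ xor c₀
    relate : ∀ {x y} → at (L i₀) x ≡ at (M i₀) y → x ≡ flip r y
    relate {x} {y} eq rewrite L₀ | M₀ = trans (flip-swap b₀ (sym eq)) (flip-xor b₀ c₀ y)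
    same : ∀ i → at (L i) v ≡ at (M i) (flip r v)
    same i with L i | M i | p i | p′ i
    ... | fix c | fix c′ | pᵢ | p′ᵢ = pᵢ
    ... | fix c | run f | pᵢ | p′ᵢ = contradiction (flip-injective f (trans (sym pᵢ) p′ᵢ)) b≢b′
    ... | run e | fix c′ | pᵢ | p′ᵢ = contradiction (flip-injective e (trans pᵢ (sym p′ᵢ))) a≢a′
    ... | run e | run f | pᵢ | p′ᵢ with flip-compare {n} e r f
    ... | inj₁ eq = trans (cong (flip e) (sym (flip-involutive r v))) (eq (flip r v))
    ... | inj₂ eq = contradiction
      (flip-injective f (opposite-fixed-unique (fixed (p i₀) pᵢ) (fixed (p′ i₀) p′ᵢ))) b≢b′
      where
      fixed : ∀ {x y} → at (L i₀) x ≡ at (M i₀) y → flip e x ≡ flip f y → opposite (flip f y) ≡ flip f y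
      fixed {x} {y} eq₀ eqᵢ = trans (sym (eq y)) (trans (cong (flip e) (sym (relate eq₀))) eqᵢ)

-- Collinearity

Col : Point n d → Point n d → Set
Col {n} x y = x ≡ y ⊎ ∃[ q ] IsLine q × ∃₂ λ a b → q a ≡ x × q b ≡ y

-- `s` and `t` stand for the parameters of two points on a common line. Two points are collinear
-- when a single pair `s`, `t` serves all coordinates.
Step : Fin n → Fin n → Fin n → Fin n → Set
Step s t v w = v ≡ w ⊎ ∃[ b ] v ≡ flip b s × w ≡ flip b t

col⇒step : {x y : Point n d} → Col x y → x ≡ y ⊎ ∃₂ λ s t → ∀ i → Step s t (x ! i) (y ! i)
col⇒step (inj₁ eq) = inj₁ eq
col⇒step {x = x} {y} (inj₂ (q , (L , _ , θ , _ , q≡) , a , b , refl , refl)) = inj₂ (θ a , θ b , step)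
  where
  step : ∀ i → Step (θ a) (θ b) (q a ! i) (q b ! i)
  step i with L i | q≡ a i | q≡ b i
  ... | fix c | eqa | eqb = inj₁ (trans eqa (sym eqb))
  ... | run e | eqa | eqb = inj₂ (e , eqa , eqb)

stepDir : ∀ {s t v w : Fin n} → Step s t v w → Dir n
stepDir {v = v} (inj₁ _) = fix v
stepDir (inj₂ (b , _)) = run b

stepDir-source : ∀ {s t v w : Fin n} (st : Step s t v w) → at (stepDir st) s ≡ v
stepDir-source (inj₁ _) = refl
stepDir-source (inj₂ (b , eq , _)) = sym eq

stepDir-target : ∀ {s t v w : Fin n} (st : Step s t v w) → at (stepDir st) t ≡ w
stepDir-target (inj₁ eq) = eq
stepDir-target (inj₂ (b , _ , eq)) = sym eq

stepDir-moves : ∀ {s t v w : Fin n} (st : Step s t v w) → v ≡ w ⊎ ∃[ b ] stepDir st ≡ run b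
stepDir-moves (inj₁ eq) = inj₁ eq
stepDir-moves (inj₂ (b , _)) = inj₂ (b , refl)

step⇒col : {x y : Point n d} → ∀ s t → (∀ i → Step s t (x ! i) (y ! i)) → Col x y
step⇒col {n} {d} {x} {y} s t step with all⊎some (λ i → stepDir-moves (step i))
... | inj₁ eq = inj₁ (point-ext eq)
... | inj₂ mv = inj₂ (ev L , ev-isLine L mv , s , t ,
  point-ext (λ i → trans (ev-! L s i) (stepDir-source (step i))) ,
  point-ext (λ i → trans (ev-! L t i) (stepDir-target (step i))))
  where
  L : Code n d
  L i = stepDir (step i)

-- Line-preserving maps

Pres : Map n d → Set
Pres σ = Inj σ × (∀ q → IsLine q → IsLine (σ ∘ q))

Pres-∘ : {σ τ : Map n d} → Pres σ → Pres τ → Pres (σ ∘ τ)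
Pres-∘ {σ = σ} {τ} (σ-inj , σ-line) (τ-inj , τ-line) =
  τ-inj ∘ σ-inj , λ q → σ-line (τ ∘ q) ∘ τ-line q

Pres-iterate : {σ : Map n d} → Pres σ → ∀ j → Pres (iterate j σ)
Pres-iterate σ-pres zero = id , λ q → id
Pres-iterate σ-pres (suc j) = Pres-∘ (Pres-iterate σ-pres j) σ-pres

col-pres : {σ : Map n d} → Pres σ → ∀ {x y} → Col x y → Col (σ x) (σ y)
col-pres {σ = σ} _ (inj₁ eq) = inj₁ (cong σ eq)
col-pres {σ = σ} (_ , σ-line) (inj₂ (q , line , a , b , qa , qb)) =
  inj₂ (σ ∘ q , σ-line q line , a , b , cong σ qa , cong σ qb)

-- Flags: a point q a on a line q

Rich : (Fin n → Point n d) → Fin n → Set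
Rich {n} {d} q a = ∃[ q′ ] IsLine q′ × q′ a ≡ q a × (∀ j k → j ≢ a → q′ j ≢ q k) × (∀ j → Col (q j) (q′ j))

rich-pres : {σ : Map n d} → Pres σ → ∀ {q a} → Rich q a → Rich (σ ∘ q) a
rich-pres {σ = σ} σ-pres@(σ-inj , σ-line) (q′ , line , meet , apart , col) =
  σ ∘ q′ , σ-line q′ line , cong σ meet , (λ j k j≢a → apart j k j≢a ∘ σ-inj) , λ j → col-pres σ-pres (col j)

rich-resp : {q r : Fin n → Point n d} → (∀ j → q j ≡ r j) → ∀ {a} → Rich q a → Rich r a
rich-resp q≗r {a} (q′ , line , meet , apart , col) =
  q′ , line , trans meet (q≗r a) , (λ j k j≢a → subst (q′ j ≢_) (q≗r k) (apart j k j≢a)) ,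
  λ j → subst (λ x → Col x (q′ j)) (q≗r j) (col j)

rich-reflect : {σ : Map n d} → Pres σ → ∀ {q a} → Rich (σ ∘ q) a → Rich q a
rich-reflect {σ = σ} σ-pres {q} rich =
  let j , inv = inverse-is-iterate σ (proj₁ σ-pres)
  in rich-resp (λ k → inv (q k)) (rich-pres (Pres-iterate σ-pres j) rich)

col-single : {x y : Point n d} → ∀ i → (∀ j → j ≢ i → x ! j ≡ y ! j) → Col x y
col-single {x = x} {y} i eq = step⇒col (x ! i) (y ! i) step
  where
  step : ∀ j → Step (x ! i) (y ! i) (x ! j) (y ! j)
  step j with j ≟ i
  ... | yes refl = inj₂ (false , refl , refl)
  ... | no j≢i = inj₁ (eq j j≢i)

set : Code n d → Fin d → Dir n → Code n d
set L j D = updateAt L j (const D)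

-- The companion line freezes coordinate `j` at its value at `a` and still runs in coordinate `i`.
-- Matched points differ in coordinate `j` alone, hence are collinear along that axis.
rich-diagonal : {q : Fin n → Point n d} → ∀ {L θ} → Inj θ → Reads q L θ →
  ∀ {i j b c} → i ≢ j → L i ≡ run b → L j ≡ run c → ∀ a → Rich q a
rich-diagonal {q = q} {L} {θ} θ-inj q≡ {i} {j} {b} {c} i≢j Lᵢ Lⱼ a =
  q′ , line , point-ext meet , apart , λ k → col-single j (λ i i≢j → sym (off k i i≢j))
  where
  D = fix (at (L j) (θ a))
  L′ = set L j D
  q′ = λ k → ev L′ (θ k)
  off : ∀ k i → i ≢ j → q′ k ! i ≡ q k ! i
  off k i i≢j = trans (ev-! L′ (θ k) i)
    (trans (cong (λ D → at D (θ k)) (updateAt-minimal i j L i≢j)) (sym (q≡ k i)))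
  on : ∀ k → q′ k ! j ≡ at (L j) (θ a)
  on k = trans (ev-! L′ (θ k) j) (cong (λ D → at D (θ k)) (updateAt-updates j L))
  line : IsLine q′
  line = L′ , (i , b , trans (updateAt-minimal i j L i≢j) Lᵢ) , θ , θ-inj , λ k → ev-! L′ (θ k)
  meet : ∀ i → q′ a ! i ≡ q a ! i
  meet i with i ≟ j
  ... | yes refl = trans (on a) (sym (q≡ a i))
  ... | no i≢j = off a i i≢j
  apart : ∀ k m → k ≢ a → q′ k ≢ q m
  apart k m k≢a eq = k≢a (trans (θ-inj (at-run Lᵢ
      (trans (sym (q≡ k i)) (trans (sym (off k i i≢j)) (trans (cong (_! i) eq) (q≡ m i))))))
    (sym (θ-inj (at-run Lⱼ (trans (sym (on k)) (trans (cong (_! j) eq) (q≡ m j)))))))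

Axis : Fin d → (Fin n → Point n d) → Set
Axis i q = (∀ j a b → j ≢ i → q a ! j ≡ q b ! j) × Inj (λ a → q a ! i)

-- The companion line runs in coordinate `j` as well, with orientation `c`. It passes through `q a`
-- because the two coordinates agree there up to `c`, and matched points again differ in coordinate
-- `j` alone.
rich-axis : {q : Fin n → Point n d} → ∀ {i} → Axis i q →
  ∀ {j a c} → j ≢ i → q a ! j ≡ flip c (q a ! i) → Rich q a
rich-axis {n} {d} {q} {i} (off , θ-inj) {j} {a} {c} j≢i meets =
  q′ , line , point-ext (λ l → trans (ev-! L′ (θ a) l) (meet l)) , apart ,
  λ k → col-single j (λ l l≢j → sym (trans (ev-! L′ (θ k) l) (same k l l≢j)))
  where
  θ : Fin n → Fin n
  θ k = q k ! i
  L L₁ L′ : Code n d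
  L l = fix (q a ! l)
  L₁ = set L i (run false)
  L′ = set L₁ j (run c)
  q′ = λ k → ev L′ (θ k)
  L′ᵢ : L′ i ≡ run false
  L′ᵢ = trans (updateAt-minimal i j L₁ (j≢i ∘ sym)) (updateAt-updates i L)
  L′ⱼ : L′ j ≡ run c
  L′ⱼ = updateAt-updates j L₁
  line : IsLine q′
  line = L′ , (i , false , L′ᵢ) , θ , θ-inj , λ k → ev-! L′ (θ k)
  same : ∀ k l → l ≢ j → at (L′ l) (θ k) ≡ q k ! l
  same k l l≢j with l ≟ i
  ... | yes refl = cong (λ D → at D (θ k)) L′ᵢ
  ... | no l≢i = trans (cong (λ D → at D (θ k))
    (trans (updateAt-minimal l j L₁ l≢j) (updateAt-minimal l i L l≢i))) (off l a k l≢i)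
  meet : ∀ l → at (L′ l) (θ a) ≡ q a ! l
  meet l with l ≟ j
  ... | yes refl = trans (cong (λ D → at D (θ a)) L′ⱼ) (sym meets)
  ... | no l≢j = same a l l≢j
  apart : ∀ k m → k ≢ a → q′ k ≢ q m
  apart k m k≢a eq = k≢a (θ-inj (flip-injective c (trans (cong (λ D → at D (θ k)) (sym L′ⱼ))
    (trans (sym (ev-! L′ (θ k) j)) (trans (cong (_! j) eq) (trans (off j m a j≢i) meets))))))

Isolated : Point n d → Fin d → Set
Isolated x i = ∀ j → j ≢ i → ∀ c → x ! j ≢ flip c (x ! i)

poor⇒isolated : {q : Fin n → Point n d} → IsLine q → ∀ {a} → ¬ Rich q a →
  ∃[ i ] Axis i q × Isolated (q a) i
poor⇒isolated {n} {d} {q} (L , (i , b , Lᵢ) , θ , θ-inj , q≡) {a} poor =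
  i , axis , λ j j≢i c eq → poor (rich-axis axis {c = c} j≢i eq)
  where
  axis : Axis i q
  axis = off , λ {k} {m} eq → θ-inj (at-run Lᵢ (trans (sym (q≡ k i)) (trans eq (q≡ m i))))
    where
    off : ∀ j k m → j ≢ i → q k ! j ≡ q m ! j
    off j k m j≢i with L j in Lⱼ | q≡ k j | q≡ m j
    ... | fix c | eqk | eqm = trans eqk (sym eqm)
    ... | run c | _ | _ = contradiction (rich-diagonal θ-inj q≡ (j≢i ∘ sym) Lᵢ Lⱼ a) poor

-- Writing α for the isolated coordinate, a rich companion line would have to fix it and run
-- through some other coordinate β. Collinearity then matches only the points of q whose
-- i-th coordinate is β or its opposite, and matches them to α and its opposite: too few.
isolated⇒poor : {q : Fin (suc (suc (suc n))) → Point (suc (suc (suc n))) d} →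
  ∀ {i a} → Axis i q → Isolated (q a) i → ¬ Rich q a
isolated⇒poor {q = q} {i} {a} (off , θ-inj) iso
  (q′ , line@(L , (i′ , b′ , Lᵢ′) , θ′ , θ′-inj , q′≡) , meet , apart , col) with L i in Lᵢ
-- If `q′` runs in coordinate `i`, then isolation keeps every other coordinate of `q′` constant. So
-- `q′` stays on the line `q`, and its point at any index `c` other than `a` violates `apart`.
... | run b = contradiction (point-ext same) (apart c m c≢a)
  where
  c = proj₁ (third a a)
  c≢a = proj₁ (proj₂ (third a a))
  hit = Inj⇒surjective _ θ-inj (q′ c ! i)
  m = proj₁ hit
  same : ∀ j → q′ c ! j ≡ q m ! j
  same j with j ≟ i
  ... | yes refl = sym (proj₂ hit)
  ... | no j≢i with L j in Lⱼ | q′≡ c j | q′≡ a j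
  ... | fix v | eqc | eqa = trans eqc (trans (sym eqa) (trans (cong (_! j) meet) (off j a m j≢i)))
  ... | run e | eqc | eqa = contradiction eq (iso j j≢i (e xor b))
    where
    eq : q a ! j ≡ flip (e xor b) (q a ! i)
    eq = trans (cong (_! j) (sym meet)) (trans eqa (trans (cong (flip e)
      (flip-swap b (trans (cong (_! i) (sym meet)) (trans (q′≡ a i) (cong (λ D → at D (θ′ a)) Lᵢ)))))
      (flip-xor e b _)))
... | fix v = go (opposite α ≟ α)
  where
  α = q a ! i
  β = q a ! i′
  fixed : ∀ j → q′ j ! i ≡ α
  fixed j = trans (trans (q′≡ j i) (cong (λ D → at D (θ′ j)) Lᵢ))
    (trans (sym (trans (q′≡ a i) (cong (λ D → at D (θ′ a)) Lᵢ))) (cong (_! i) meet))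
  i′≢i : i′ ≢ i
  i′≢i refl with () ← trans (sym Lᵢ) Lᵢ′
  run-inj : Inj (λ j → q′ j ! i′)
  run-inj {j} {k} eq = θ′-inj (at-run Lᵢ′ (trans (sym (q′≡ j i′)) (trans eq (q′≡ k i′))))
  matched : ∀ j → j ≢ a → ∃[ c ] q j ! i ≡ flip c β × q′ j ! i′ ≡ flip c α
  matched j j≢a with col⇒step (col j)
  ... | inj₁ eq = contradiction (sym eq) (apart j j j≢a)
  ... | inj₂ (s , t , step) with step i | step i′
  ... | inj₁ eq | _ = contradiction (θ-inj (trans eq (fixed j))) j≢a
  ... | inj₂ _ | inj₁ eq =
    contradiction (run-inj (trans (sym eq) (trans (off i′ j a i′≢i) (cong (_! i′) (sym meet))))) j≢a
  ... | inj₂ (e , qi , q′i) | inj₂ (f , qi′ , q′i′) =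
    e xor f ,
    trans qi (trans (cong (flip e) (flip-swap f (trans (off i′ a j i′≢i) qi′))) (flip-xor e f β)) ,
    trans q′i′ (trans (cong (flip f) (flip-swap e (trans (sym (fixed j)) q′i)))
      (trans (flip-xor f e α) (cong (λ b → flip b α) (xor-comm f e))))
  go : Dec (opposite α ≡ α) → ⊥
  -- The point of `q` whose `i`-th coordinate is the opposite of `α` is matched too, which puts `β`
  -- in the orbit of `α` against isolation.
  go (no ᾱ≢α) with Inj⇒surjective _ θ-inj (opposite α)
  ... | l , eq with matched l (λ { refl → ᾱ≢α (sym eq) })
  ... | c , ql , _ = iso i′ i′≢i (c xor true) (trans (flip-swap c (trans (sym eq) ql)) (flip-xor c true α))
  -- If `α` is the centre, every point of `q′` other than the one at `a` has `i′`-th coordinate `α`.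
  -- As n is at least 3 there are two of them, although `q′` runs in that coordinate.
  go (yes ᾱ≡α) = third-is-distinct (run-inj (trans (toα j j≢a) (sym (toα h h≢a))))
    where
    j = proj₁ (third a a)
    j≢a = proj₁ (proj₂ (third a a))
    h = proj₁ (third a j)
    h≢a = proj₁ (proj₂ (third a j))
    third-is-distinct : j ≢ h
    third-is-distinct = proj₂ (proj₂ (third a j)) ∘ sym
    flip-α : ∀ c → flip c α ≡ α
    flip-α false = refl
    flip-α true = ᾱ≡α
    toα : ∀ l → l ≢ a → q′ l ! i′ ≡ α
    toα l l≢a = let c , _ , eq = matched l l≢a in trans eq (flip-α c)

-- Adjacency of cube vertices

Adj : Point n d → Point n d → Set
Adj {n} {d} x y = ∃[ q ] IsLine q × ∃₂ λ a b → a ≢ b × q a ≡ x × q b ≡ y ×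
  Rich q a × Rich q b × (∀ c → c ≢ a → c ≢ b → ¬ Rich q c)

adj-pres : {σ : Map n d} → Pres σ → ∀ {x y} → Adj x y → Adj (σ x) (σ y)
adj-pres {σ = σ} σ-pres (q , line , a , b , a≢b , qa , qb , ra , rb , poor) =
  σ ∘ q , proj₂ σ-pres q line , a , b , a≢b , cong σ qa , cong σ qb ,
  rich-pres σ-pres ra , rich-pres σ-pres rb , λ c c≢a c≢b → poor c c≢a c≢b ∘ rich-reflect σ-pres

-- The last two clauses make `x` a vertex of a nondegenerate cube {v, n - 1 - v}^d; the first two
-- make `y` its neighbour in direction `i`.
Flipped : Fin d → Point n d → Point n d → Set
Flipped i x y = (∀ j → j ≢ i → y ! j ≡ x ! j) × y ! i ≡ opposite (x ! i) × x ! i ≢ opposite (x ! i)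
  × (∀ j → ∃[ c ] x ! j ≡ flip c (x ! i))

-- A third point of the line is poor, so the line is parallel to an axis `i`. The `i`-th coordinates
-- of the two rich points form a set closed under reflection, and each other coordinate lies in this
-- set.
adj⇒flipped : {x y : Point (suc (suc (suc n))) d} → Adj x y → ∃[ i ] Flipped i x y
adj⇒flipped {n} {d} (q , line , a , b , a≢b , refl , refl , ra , rb , poor)
  with c , c≢a , c≢b ← third a b
  with i , axis@(off , θ-inj) , _ ← poor⇒isolated line (poor c c≢a c≢b)
  = i , (λ j → off j b a) , flipped , (λ eq → x≢y (trans eq (sym flipped))) , unique-orbit
  where
  x≢y : q a ! i ≢ q b ! i
  x≢y = a≢b ∘ θ-inj
  -- The point of the line whose i-th coordinate is a given value in the orbit of q a ! j is rich.
  orbit-in : ∀ j → j ≢ i → ∀ e → flip e (q a ! j) ≡ q a ! i ⊎ flip e (q a ! j) ≡ q b ! i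
  orbit-in j j≢i e with l , eq ← Inj⇒surjective _ θ-inj (flip e (q a ! j)) with l ≟ a | l ≟ b
  ... | yes refl | _ = inj₁ (sym eq)
  ... | no _ | yes refl = inj₂ (sym eq)
  ... | no l≢a | no l≢b = contradiction
    (rich-axis axis {c = e} j≢i (trans (off j l a j≢i) (flip-swap e eq))) (poor l l≢a l≢b)
  orbit-mate : ∀ l → Rich q l → ∃[ j ] j ≢ i × ∃[ e ] q l ! j ≡ flip e (q l ! i)
  orbit-mate l rich with some? (λ j → ¬? (j ≟ i) ×-dec ((q l ! j ≟ q l ! i) ⊎-dec (q l ! j ≟ opposite (q l ! i))))
  ... | yes (j , j≢i , inj₁ eq) = j , j≢i , false , eq
  ... | yes (j , j≢i , inj₂ eq) = j , j≢i , true , eq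
  ... | no none = contradiction rich (isolated⇒poor axis λ
    { j j≢i false eq → none (j , j≢i , inj₁ eq) ; j j≢i true eq → none (j , j≢i , inj₂ eq) })
  closed : ∀ l → Rich q l → opposite (q l ! i) ≡ q a ! i ⊎ opposite (q l ! i) ≡ q b ! i
  closed l rich with j , j≢i , e , eq ← orbit-mate l rich =
    subst (λ v → v ≡ q a ! i ⊎ v ≡ q b ! i)
      (trans (cong (flip (not e)) (trans (off j a l j≢i) eq))
        (trans (flip-not e _) (cong opposite (flip-involutive e _))))
      (orbit-in j j≢i (not e))
  flipped : q b ! i ≡ opposite (q a ! i)
  -- The reflection cannot fix both values, since only the centre is fixed; hence it exchanges them.
  flipped with closed a ra | closed b rb
  ... | inj₂ eq | _ = sym eq
  ... | inj₁ eq | inj₁ eq′ = trans (sym (opposite-involutive _)) (cong opposite eq′)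
  ... | inj₁ eq | inj₂ eq′ = contradiction (opposite-fixed-unique eq eq′) x≢y
  unique-orbit : ∀ j → ∃[ e ] q a ! j ≡ flip e (q a ! i)
  unique-orbit j with j ≟ i
  ... | yes refl = false , refl
  ... | no j≢i with orbit-in j j≢i false
  ... | inj₁ eq = false , eq
  ... | inj₂ eq = true , trans eq flipped

-- The image of a line is a line, and lines with two common points coincide. So the images of two
-- points locate the images of all.
image-line : {σ : Map n d} → Pres σ → {L M : Code n d} → Moves L → ∀ {a a′ b b′} → a ≢ a′ →
  (∀ i → σ (ev L a) ! i ≡ at (M i) b) → (∀ i → σ (ev L a′) ! i ≡ at (M i) b′) →
  ∀ v → ∃[ w ] (∀ i → σ (ev L v) ! i ≡ at (M i) w)
image-line (_ , σ-line) {L} {M} mv {a} {a′} a≢a′ p p′ v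
  with L′ , mv′ , θ , θ-inj , σ≡ ← σ-line (ev L) (ev-isLine L mv)
  with w , eq ← line-unique {M = M} mv′ (a≢a′ ∘ θ-inj)
    (λ i → trans (sym (σ≡ a i)) (p i)) (λ i → trans (sym (σ≡ a′ i)) (p′ i)) (θ v)
  = w , λ i → trans (σ≡ v i) (eq i)

axis⇒line : {q : Fin n → Point n d} → ∀ {i} → Axis i q → Fin n → IsLine q
axis⇒line {n} {d} {q} {i} (off , θ-inj) a =
  L , (i , false , updateAt-updates i _) , (λ k → q k ! i) , θ-inj , reads
  where
  L : Code n d
  L = set (λ l → fix (q a ! l)) i (run false)
  reads : Reads q L (λ k → q k ! i)
  reads k l with l ≟ i
  ... | yes refl = sym (cong (λ D → at D (q k ! l)) (updateAt-updates l _))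
  ... | no l≢i = trans (off l k a l≢i) (sym (cong (λ D → at D (q k ! i)) (updateAt-minimal l i _ l≢i)))

orbit? : (v w : Fin n) → Dec (∃[ c ] v ≡ flip c w)
orbit? v w with v ≟ w | v ≟ opposite w
... | yes eq | _ = yes (false , eq)
... | no _ | yes eq = yes (true , eq)
... | no v≢w | no v≢w̄ = no λ { (false , eq) → v≢w eq ; (true , eq) → v≢w̄ eq }

_∉orbit_ : Fin n → Fin n → Set
v ∉orbit w = ∀ c → v ≢ flip c w

flip-∉orbit : ∀ b {v w : Fin n} → v ∉orbit w → flip b v ∉orbit w
flip-∉orbit b {v} {w} v∉ c eq = v∉ (b xor c) (trans (flip-swap b (sym eq)) (flip-xor b c w))

other : (i : Fin (suc (suc d))) → ∃[ j ] j ≢ i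
other zero = suc zero , λ ()
other (suc i) = zero , λ ()

bit-cases : ∀ b c → c ≡ b ⊎ c ≡ not b
bit-cases false false = inj₁ refl
bit-cases false true = inj₂ refl
bit-cases true false = inj₂ refl
bit-cases true true = inj₁ refl

-- Coordinate `j` changes, so the parameter of `y` on the joining line is in the orbit of `u`. If
-- coordinate `i` changed too, its value at `y` would lie in that orbit. This is the tool for
-- carrying one coordinate of an image from a known point to a new one.
col-stays : {y y′ : Point n d} → ∀ {u i j} c → Col y y′ → (y ! i) ∉orbit u →
  y ! j ≡ flip c u → y ! j ≢ y′ ! j → y ! i ≡ y′ ! i
col-stays {u = u} {i} {j} c col yᵢ∉ yⱼ y≢y′ with col⇒step col
... | inj₁ refl = refl
... | inj₂ (s , t , step) with step i | step j
... | inj₁ eq | _ = eq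
... | inj₂ _ | inj₁ eq = contradiction eq y≢y′
... | inj₂ (b , yᵢ , _) | inj₂ (b′ , yⱼ′ , _) = contradiction
  (trans yᵢ (trans (cong (flip b) (trans (flip-swap b′ (trans (sym yⱼ) yⱼ′)) (flip-xor b′ c u))) (flip-xor b (b′ xor c) u)))
  (yᵢ∉ (b xor (b′ xor c)))

-- Corners

corner : Fin n → (Fin d → Bool) → Point n d
corner u β = pt λ i → flip (β i) u

corner-! : (u : Fin n) → (β : Fin d → Bool) → ∀ i → corner u β ! i ≡ flip (β i) u
corner-! u β = pt-! _

corner-cong : (u : Fin n) → {β γ : Fin d → Bool} → β ≗ γ → corner u β ≡ corner u γ
corner-cong u {β} {γ} β≗γ = point-ext λ i →
  trans (corner-! u β i) (trans (cong (λ b → flip b u) (β≗γ i)) (sym (corner-! u γ i)))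

origin : Fin d → Bool
origin = const false

unit : Fin d → Fin d → Bool
unit i = updateAt origin i (const true)

unit-on : (i : Fin d) → unit i i ≡ true
unit-on i = updateAt-updates i origin

unit-off : ∀ {i k : Fin d} → k ≢ i → unit i k ≡ false
unit-off {i = i} {k} k≢i = updateAt-minimal k i origin k≢i

-- On the line through both corners, all coordinates other than `i` are 0 or n - 1, so the two ends
-- are rich and all points between them poor. Richness of the ends needs a second coordinate, which
-- `other` supplies.
corner-adj : {β γ : Fin (suc (suc d)) → Bool} → ∀ i → γ i ≡ not (β i) → (∀ j → j ≢ i → γ j ≡ β j) →
  Adj {suc (suc (suc n))} (corner zero β) (corner zero γ)
corner-adj {d} {n} {β} {γ} i γᵢ γ-off =
  q , axis⇒line {q = q} axis zero , a , b , a≢b , point-ext at-a , point-ext at-b ,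
  rich (β i) , rich (not (β i)) , poor
  where
  N = suc (suc (suc n))
  z : Fin (suc (suc d)) → Fin N
  z j = flip (β j) zero
  q : Fin N → Point N (suc (suc d))
  q v = pt (updateAt z i (const v))
  on : ∀ v → q v ! i ≡ v
  on v = trans (pt-! _ i) (updateAt-updates i z)
  off : ∀ v j → j ≢ i → q v ! j ≡ z j
  off v j j≢i = trans (pt-! _ j) (updateAt-minimal j i z j≢i)
  axis : Axis i q
  axis = (λ j v w j≢i → trans (off v j j≢i) (sym (off w j j≢i))) , λ {v} {w} eq → trans (sym (on v)) (trans eq (on w))
  a b : Fin N
  a = flip (β i) zero
  b = flip (not (β i)) zero
  a≢b : a ≢ b
  a≢b eq with β i
  ... | false = zero≢opposite eq
  ... | true = zero≢opposite (sym eq)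
  at-a : ∀ j → q a ! j ≡ corner zero β ! j
  at-a j with j ≟ i
  ... | yes refl = trans (on a) (sym (corner-! zero β j))
  ... | no j≢i = trans (off a j j≢i) (sym (corner-! zero β j))
  at-b : ∀ j → q b ! j ≡ corner zero γ ! j
  at-b j with j ≟ i
  ... | yes refl = trans (on b) (trans (cong (λ c → flip c zero) (sym γᵢ)) (sym (corner-! zero γ j)))
  ... | no j≢i = trans (off b j j≢i) (trans (cong (λ c → flip c zero) (sym (γ-off j j≢i))) (sym (corner-! zero γ j)))
  rich : ∀ c → Rich q (flip c zero)
  rich c with j , j≢i ← other i = rich-axis {q = q} axis {c = β j xor c} j≢i
    (trans (off _ j j≢i) (trans (cong (flip (β j)) (sym (flip-involutive c zero)))
      (trans (flip-xor (β j) c _) (cong (flip (β j xor c)) (sym (on _))))))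
  poor : ∀ v → v ≢ a → v ≢ b → ¬ Rich q v
  poor v v≢a v≢b = isolated⇒poor {q = q} axis λ j j≢i c eq →
    let v≡ : v ≡ flip (c xor β j) zero
        v≡ = trans (flip-swap c (trans (sym (off v j j≢i)) (trans eq (cong (flip c) (on v))))) (flip-xor c (β j) zero)
    in [ (λ eq → v≢a (trans v≡ (cong (λ e → flip e zero) eq))) , (λ eq → v≢b (trans v≡ (cong (λ e → flip e zero) eq))) ]′
       (bit-cases (β i) (c xor β j))

erase : (Fin d → Bool) → Fin d → Fin d → Bool
erase β i = updateAt β i (const false)

erase-on : (β : Fin d → Bool) → ∀ i → erase β i i ≡ false
erase-on β i = updateAt-updates i β

erase-off : (β : Fin d → Bool) → ∀ {i j} → j ≢ i → erase β i j ≡ β j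
erase-off β {i} {j} j≢i = updateAt-minimal j i β j≢i

erase-count : (β : Fin d → Bool) → ∀ i → β i ≡ true → count (erase β i) < count β
erase-count β i βᵢ = count-strict below i βᵢ (erase-on β i)
  where
  below : ∀ j → erase β i j ≡ true → β j ≡ true
  below j eq with j ≟ i
  ... | yes refl = βᵢ
  ... | no j≢i = trans (sym (erase-off β j≢i)) eq

-- The corners obtained by erasing coordinate i or coordinate j have only two common neighbours.
common-neighbour : {u : Fin n} → u ≢ opposite u → {β : Fin d → Bool} → ∀ {i j} → j ≢ i →
  β i ≡ true → β j ≡ true → {y : Point n d} →
  ∃[ k ] Flipped k (corner u (erase β i)) y → ∃[ l ] Flipped l (corner u (erase β j)) y →
  y ≢ corner u (erase (erase β i) j) → y ≡ corner u β
common-neighbour {u = u} u≢ū {β} {i} {j} j≢i βᵢ βⱼ {y} (k , off-k , on-k , _) (l , off-l , _) y≢ =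
  point-ext λ t → trans (value t) (sym (corner-! u β t))
  where
  away : ∀ i k → (∀ t → t ≢ k → y ! t ≡ corner u (erase β i) ! t) →
    ∀ t → t ≢ k → t ≢ i → y ! t ≡ flip (β t) u
  away i k off t t≢k t≢i = trans (off t t≢k) (trans (corner-! u (erase β i) t) (cong (λ b → flip b u) (erase-off β t≢i)))
  erased : ∀ i k → (∀ t → t ≢ k → y ! t ≡ corner u (erase β i) ! t) → i ≢ k → y ! i ≡ u
  erased i k off i≢k = trans (off i i≢k) (trans (corner-! u (erase β i) i) (cong (λ b → flip b u) (erase-on β i)))
  kept : ∀ i → β i ≡ true → y ! i ≡ flip (β i) u → y ! i ≢ u
  kept i βᵢ yᵢ eq = u≢ū (trans (sym eq) (trans yᵢ (cong (λ b → flip b u) βᵢ)))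
  -- If `k` is not `i`, then coordinate `i` of `y` is `u`, which forces `l` to be `i`. Then
  -- coordinate `j` is `u` as well, which forces `k` to be `j`, and `y` is the excluded common
  -- neighbour.
  k≡i : k ≡ i
  k≡i with k ≟ i
  ... | yes k≡i = k≡i
  ... | no k≢i = contradiction (point-ext λ t → trans (go t) (sym (corner-! u (erase (erase β i) j) t))) y≢
    where
    yᵢ : y ! i ≡ u
    yᵢ = erased i k off-k (k≢i ∘ sym)
    l≡i : l ≡ i
    l≡i with l ≟ i
    ... | yes l≡i = l≡i
    ... | no l≢i = contradiction yᵢ (kept i βᵢ (away j l off-l i (l≢i ∘ sym) (j≢i ∘ sym)))
    yⱼ : y ! j ≡ u
    yⱼ = erased j l off-l (λ j≡l → j≢i (trans j≡l l≡i))
    k≡j : k ≡ j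
    k≡j with k ≟ j
    ... | yes k≡j = k≡j
    ... | no k≢j = contradiction yⱼ (kept j βⱼ (away i k off-k j (k≢j ∘ sym) j≢i))
    go : ∀ t → y ! t ≡ flip (erase (erase β i) j t) u
    go t with t ≟ j
    ... | yes refl = trans yⱼ (cong (λ b → flip b u) (sym (erase-on (erase β i) j)))
    ... | no t≢j with t ≟ i
    ... | yes refl = trans yᵢ (cong (λ b → flip b u) (sym (trans (erase-off (erase β i) t≢j) (erase-on β i))))
    ... | no t≢i = trans (away i k off-k t (λ t≡k → t≢j (trans t≡k k≡j)) t≢i)
      (cong (λ b → flip b u) (sym (trans (erase-off (erase β i) t≢j) (erase-off β t≢i))))
  value : ∀ t → y ! t ≡ flip (β t) u
  value t with t ≟ i
  ... | no t≢i = away i k off-k t (λ t≡k → t≢i (trans t≡k k≡i)) t≢i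
  ... | yes refl = trans (subst (λ k → y ! k ≡ opposite (corner u (erase β i) ! k)) k≡i on-k)
    (trans (cong opposite (trans (corner-! u (erase β i) i) (cong (λ b → flip b u) (erase-on β i))))
      (cong (λ b → flip b u) (sym βᵢ)))

-- The line joining the corner `β` of the cube of `u`, at parameter `u`, to the corner with the
-- coordinates in `S` reflected, at the opposite parameter.
cornerLine : Fin n → (Fin d → Bool) → (Fin d → Bool) → Code n d
cornerLine u β S i = if S i then run (β i) else fix (flip (β i) u)

cornerLine-on : ∀ {u : Fin n} {β S : Fin d → Bool} {i} → S i ≡ true → ∀ v → at (cornerLine u β S i) v ≡ flip (β i) v
cornerLine-on Sᵢ v rewrite Sᵢ = refl

cornerLine-off : ∀ {u : Fin n} {β S : Fin d → Bool} {i} → S i ≡ false → ∀ v → at (cornerLine u β S i) v ≡ flip (β i) u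
cornerLine-off Sᵢ v rewrite Sᵢ = refl

cornerLine-moves : ∀ {u : Fin n} {β S : Fin d → Bool} {i} → S i ≡ true → Moves (cornerLine u β S)
cornerLine-moves {u = u} {β} {S} {i} Sᵢ = i , β i , cong (λ b → if b then run (β i) else fix (flip (β i) u)) Sᵢ

cornerLine-corner : ∀ (u : Fin n) (β S : Fin d → Bool) c i →
  at (cornerLine u β S i) (flip c u) ≡ flip (β i xor (c ∧ S i)) u
cornerLine-corner u β S c i with S i
... | true = trans (flip-xor (β i) c u) (cong (λ b → flip (β i xor b) u) (sym (∧-identityʳ c)))
... | false = cong (λ b → flip b u) (sym (trans (cong (β i xor_) (∧-zeroʳ c)) (xor-identityʳ (β i))))

-- Maps that respect the axes at the origin corner

module Normalised {m e : ℕ} (σ : Map (suc (suc (suc m))) (suc (suc e))) (σ-pres : Pres σ)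
  (u : Fin (suc (suc (suc m)))) (u≢ū : u ≢ opposite u)
  (σ-origin : σ (corner zero origin) ≡ corner u origin)
  (σ-unit : ∀ i → σ (corner zero (unit i)) ≡ corner u (unit i)) where

  N D : ℕ
  N = suc (suc (suc m))
  D = suc (suc e)

  σ-inj : Inj σ
  σ-inj = proj₁ σ-pres

  o : Fin N
  o = zero

  erase-adj : ∀ β i → β i ≡ true → ∃[ k ] Flipped k (σ (corner o (erase β i))) (σ (corner o β))
  erase-adj β i βᵢ = adj⇒flipped (adj-pres σ-pres (corner-adj i
    (trans βᵢ (cong not (sym (erase-on β i)))) (λ j j≢i → sym (erase-off β j≢i))))

  -- Induction on the number of reflected coordinates, bounded by `s`. With two of them, the image
  -- is a common neighbour of two corners known by induction. The other common neighbour is already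
  -- the image of the corner with both erased, so injectivity excludes it.
  σ-corner′ : ∀ s β → count β < s → σ (corner o β) ≡ corner u β
  σ-corner′ (suc s) β (s≤s β≤s) with some? (λ i → β i ≟ᵇ true)
  ... | no none = trans (cong σ (corner-cong o β≗origin)) (trans σ-origin (corner-cong u (sym ∘ β≗origin)))
    where
    β≗origin : β ≗ origin
    β≗origin i with β i in βᵢ
    ... | false = refl
    ... | true = contradiction (i , βᵢ) none
  ... | yes (i , βᵢ) with some? (λ j → ¬? (j ≟ i) ×-dec (β j ≟ᵇ true))
  ... | no none = trans (cong σ (corner-cong o β≗unit)) (trans (σ-unit i) (corner-cong u (sym ∘ β≗unit)))
    where
    β≗unit : β ≗ unit i
    β≗unit j with j ≟ i
    ... | yes refl = trans βᵢ (sym (unit-on j))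
    ... | no j≢i with β j in βⱼ
    ... | false = sym (unit-off j≢i)
    ... | true = contradiction (j , j≢i , βⱼ) none
  ... | yes (j , j≢i , βⱼ) = common-neighbour u≢ū {β} j≢i βᵢ βⱼ (neighbour i βᵢ) (neighbour j βⱼ)
    (λ eq → distinct (σ-inj (trans eq (sym both))))
    where
    neighbour : ∀ i → β i ≡ true → ∃[ k ] Flipped k (corner u (erase β i)) (σ (corner o β))
    neighbour i βᵢ = subst (λ x → ∃[ k ] Flipped k x (σ (corner o β)))
      (σ-corner′ s (erase β i) (≤-trans (erase-count β i βᵢ) β≤s)) (erase-adj β i βᵢ)
    β″ : Fin D → Bool
    β″ = erase (erase β i) j
    both : σ (corner o β″) ≡ corner u β″
    both = σ-corner′ s β″ (≤-trans (<-trans (erase-count (erase β i) j (trans (erase-off β j≢i) βⱼ)) (erase-count β i βᵢ)) β≤s)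
    distinct : corner o β ≢ corner o β″
    distinct eq = zero≢opposite (sym (trans (cong (λ b → flip b o) (sym βⱼ))
      (trans (sym (corner-! o β j)) (trans (cong (_! j) eq) (trans (corner-! o β″ j)
        (cong (λ b → flip b o) (erase-on (erase β i) j)))))))

  σ-corner : ∀ β i → σ (corner o β) ! i ≡ flip (β i) u
  σ-corner β i = trans (cong (_! i) (σ-corner′ _ β ≤-refl)) (corner-! u β i)

  L₀ : (Fin D → Bool) → (Fin D → Bool) → Fin N → Point N D
  L₀ β S = ev (cornerLine o β S)

  L₀-on : ∀ β S {i} → S i ≡ true → ∀ v → L₀ β S v ! i ≡ flip (β i) v
  L₀-on β S Sᵢ v = trans (ev-! (cornerLine o β S) v _) (cornerLine-on {β = β} {S} Sᵢ v)

  L₀-off : ∀ β S {i} → S i ≡ false → ∀ v → L₀ β S v ! i ≡ flip (β i) o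
  L₀-off β S Sᵢ v = trans (ev-! (cornerLine o β S) v _) (cornerLine-off {β = β} {S} Sᵢ v)

  σ-L₀-corner : ∀ β S c i → σ (L₀ β S (flip c o)) ! i ≡ at (cornerLine u β S i) (flip c u)
  σ-L₀-corner β S c i = trans
    (cong (λ x → σ x ! i) (point-ext λ k → trans (ev-! (cornerLine o β S) (flip c o) k)
      (trans (cornerLine-corner o β S c k) (sym (corner-! o (λ k → β k xor (c ∧ S k)) k)))))
    (trans (σ-corner (λ k → β k xor (c ∧ S k)) i) (sym (cornerLine-corner u β S c i)))

  σ-L₀ : ∀ β S {i} → S i ≡ true → ∀ v → ∃[ w ] (∀ k → σ (L₀ β S v) ! k ≡ at (cornerLine u β S k) w)
  σ-L₀ β S Sᵢ = image-line σ-pres {M = cornerLine u β S} (cornerLine-moves {β = β} {S} Sᵢ) {b = u} {opposite u} zero≢opposite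
    (σ-L₀-corner β S false) (σ-L₀-corner β S true)

  σ-L₀-off : ∀ β S {i} → S i ≡ true → ∀ v {k} → S k ≡ false → σ (L₀ β S v) ! k ≡ flip (β k) u
  σ-L₀-off β S Sᵢ v {k} Sₖ with w , eq ← σ-L₀ β S Sᵢ v = trans (eq k) (cornerLine-off {β = β} {S} Sₖ w)

  -- A parameter in the orbit of `u` is already taken by the image of an end of the line.
  σ-L₀-∉ : ∀ β S {i} → S i ≡ true → ∀ {v} → v ∉orbit o → (σ (L₀ β S v) ! i) ∉orbit u
  σ-L₀-∉ β S {i} Sᵢ {v} v∉ c eq with w , eqs ← σ-L₀ β S Sᵢ v =
    v∉ (β i xor c) (IsLine-injective (ev-isLine (cornerLine o β S) (cornerLine-moves {β = β} {S} Sᵢ))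
      (σ-inj (point-ext λ k → trans (eqs k) (trans (cong (at (cornerLine u β S k)) w≡)
        (sym (σ-L₀-corner β S (β i xor c) k))))))
    where
    w≡ : w ≡ flip (β i xor c) u
    w≡ = trans (flip-swap (β i) (trans (sym eq) (trans (eqs i) (cornerLine-on {β = β} {S} Sᵢ w)))) (flip-xor (β i) c u)

  θ : Fin N → Fin N
  θ v = σ (pt (const v)) ! zero

  σ-diagonal : ∀ v i → σ (pt (const v)) ! i ≡ θ v
  -- By computation `pt (const v)` is the point at `v` of the corner line with no reflections that
  -- runs everywhere.
  σ-diagonal v i with w , eq ← σ-L₀ (const false) (const true) {zero} refl v = trans (eq i) (sym (eq zero))

  θ-corner : ∀ c → θ (flip c o) ≡ flip c u
  θ-corner c = σ-corner (const c) zero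

  θ-inj : Inj θ
  θ-inj {v} {w} eq = trans (sym (pt-! (const v) (zero {suc e})))
    (trans (cong (_! zero) (σ-inj {pt (const v)} {pt (const w)}
      (point-ext λ i → trans (σ-diagonal v i) (trans eq (sym (σ-diagonal w i))))))
      (pt-! (const w) (zero {suc e})))

  θ-∉ : ∀ {v} → v ∉orbit o → θ v ∉orbit u
  θ-∉ v∉ c eq = v∉ c (θ-inj (trans eq (sym (θ-corner c))))

  edge : (Fin D → Bool) → Fin D → Fin N → Point N D
  edge β i = L₀ β (unit i)

  -- The edge point and the diagonal point at `v` agree in coordinate `i` and are collinear, all
  -- other coordinates passing from 0 to `v`. In the image another coordinate passes from `u` to
  -- `θ v`, so `col-stays` holds coordinate `i` fixed.
  σ-edge-origin : ∀ i {v} → v ∉orbit o → σ (edge origin i v) ! i ≡ θ v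
  σ-edge-origin i {v} v∉ with j , j≢i ← other i = trans
    (col-stays false (col-pres σ-pres col) (σ-L₀-∉ origin (unit i) (unit-on i) v∉)
      (σⱼ j≢i) (λ eq → θ-∉ v∉ false (trans (sym (σ-diagonal v j)) (trans (sym eq) (σⱼ j≢i)))))
    (σ-diagonal v i)
    where
    σⱼ : ∀ {j} → j ≢ i → σ (edge origin i v) ! j ≡ u
    σⱼ j≢i = σ-L₀-off origin (unit i) (unit-on i) v (unit-off j≢i)
    step : ∀ k → Step o v (edge origin i v ! k) (pt (const v) ! k)
    step k with k ≟ i
    ... | yes refl = inj₁ (trans (L₀-on origin (unit k) (unit-on k) v) (sym (pt-! (const v) k)))
    ... | no k≢i = inj₂ (false , L₀-off origin (unit i) (unit-off k≢i) v , pt-! (const v) k)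
    col : Col (edge origin i v) (pt (const v))
    col = step⇒col o v step

  -- Comparison with the parallel edge at the origin: the two points share coordinate `i`, and a
  -- further reflected coordinate moves between opposite corner values, so `col-stays` applies.
  -- Without such a coordinate the two edges are the same line.
  σ-edge : ∀ β i {v} → v ∉orbit o → σ (edge β i v) ! i ≡ θ (flip (β i) v)
  σ-edge β i {v} v∉ with some? (λ k → ¬? (k ≟ i) ×-dec (β k ≟ᵇ true))
  ... | yes (k , k≢i , βₖ) = trans
    (sym (col-stays false (col-pres σ-pres col) (σ-L₀-∉ origin (unit i) (unit-on i) w∉)
      (σ-L₀-off origin (unit i) (unit-on i) w (unit-off k≢i))
      λ eq → u≢ū (trans (sym (σ-L₀-off origin (unit i) (unit-on i) w (unit-off k≢i))) (trans eq
        (trans (σ-L₀-off β (unit i) (unit-on i) v (unit-off k≢i)) (cong (λ b → flip b u) βₖ))))))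
    (σ-edge-origin i w∉)
    where
    w : Fin N
    w = flip (β i) v
    w∉ : w ∉orbit o
    w∉ = flip-∉orbit (β i) v∉
    step : ∀ k → Step o (opposite o) (edge origin i w ! k) (edge β i v ! k)
    step k with k ≟ i
    ... | yes refl = inj₁ (trans (L₀-on origin (unit k) (unit-on k) w) (sym (L₀-on β (unit k) (unit-on k) v)))
    ... | no k≢i with β k | L₀-off β (unit i) (unit-off k≢i) v
    ... | false | eq = inj₁ (trans (L₀-off origin (unit i) (unit-off k≢i) w) (sym eq))
    ... | true | eq = inj₂ (false , L₀-off origin (unit i) (unit-off k≢i) w , eq)
    col : Col (edge origin i w) (edge β i v)
    col = step⇒col o (opposite o) step
  ... | no none = trans (cong (λ x → σ x ! i) (point-ext same)) (σ-edge-origin i (flip-∉orbit (β i) v∉))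
    where
    same : ∀ k → edge β i v ! k ≡ edge origin i (flip (β i) v) ! k
    same k with k ≟ i
    ... | yes refl = trans (L₀-on β (unit k) (unit-on k) v) (sym (L₀-on origin (unit k) (unit-on k) (flip (β k) v)))
    ... | no k≢i with β k in βₖ | L₀-off β (unit i) (unit-off k≢i) v
    ... | false | eq = trans eq (sym (L₀-off origin (unit i) (unit-off k≢i) (flip (β i) v)))
    ... | true | _ = contradiction (k , k≢i , βₖ) none

  -- Comparison with the edge in direction `i` from the same corner: coordinate `i` agrees, while
  -- any other coordinate `j` in `S` leaves its corner value, in the image too. If there is none,
  -- the line is that edge.
  σ-L₀-on : ∀ β S {i} → S i ≡ true → ∀ {v} → v ∉orbit o → σ (L₀ β S v) ! i ≡ θ (flip (β i) v)
  σ-L₀-on β S {i} Sᵢ {v} v∉ with some? (λ j → ¬? (j ≟ i) ×-dec (S j ≟ᵇ true))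
  ... | yes (j , j≢i , Sⱼ) = trans
    (sym (col-stays (β j) (col-pres σ-pres col) (σ-L₀-∉ β (unit i) (unit-on i) v∉) σⱼ
      (λ eq → σ-L₀-∉ β S Sⱼ v∉ (β j) (trans (sym eq) σⱼ))))
    (σ-edge β i v∉)
    where
    σⱼ : σ (edge β i v) ! j ≡ flip (β j) u
    σⱼ = σ-L₀-off β (unit i) (unit-on i) v (unit-off j≢i)
    step : ∀ k → Step o v (edge β i v ! k) (L₀ β S v ! k)
    step k with k ≟ i
    ... | yes refl = inj₁ (trans (L₀-on β (unit k) (unit-on k) v) (sym (L₀-on β S Sᵢ v)))
    ... | no k≢i with S k in Sₖ
    ... | true = inj₂ (β k , L₀-off β (unit i) (unit-off k≢i) v , L₀-on β S Sₖ v)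
    ... | false = inj₁ (trans (L₀-off β (unit i) (unit-off k≢i) v) (sym (L₀-off β S Sₖ v)))
    col : Col (edge β i v) (L₀ β S v)
    col = step⇒col o v step
  ... | no none = trans (cong (λ x → σ x ! i) (point-ext same)) (σ-edge β i v∉)
    where
    same : ∀ k → L₀ β S v ! k ≡ edge β i v ! k
    same k with k ≟ i
    ... | yes refl = trans (L₀-on β S Sᵢ v) (sym (L₀-on β (unit k) (unit-on k) v))
    ... | no k≢i with S k in Sₖ
    ... | true = contradiction (k , k≢i , Sₖ) none
    ... | false = trans (L₀-off β S Sₖ v) (sym (L₀-off β (unit i) (unit-off k≢i) v))

  σ-cornerLine : ∀ β S {i} → S i ≡ true → ∀ {v} → v ∉orbit o → ∀ k → σ (L₀ β S v) ! k ≡ θ (L₀ β S v ! k)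
  σ-cornerLine β S Sᵢ {v} v∉ k with S k in Sₖ
  ... | true = trans (σ-L₀-on β S Sₖ v∉) (cong θ (sym (L₀-on β S Sₖ v)))
  ... | false = trans (σ-L₀-off β S Sᵢ v Sₖ) (trans (sym (θ-corner (β k))) (cong θ (sym (L₀-off β S Sₖ v))))

  -- For `v` off the orbit of 0, take the line running backwards in coordinate 0 and forwards
  -- elsewhere. Its image has coordinates 0 and 1 opposite to each other, and these are
  -- `θ (opposite v)` and `θ v`.
  θ-opposite : ∀ v → θ (opposite v) ≡ opposite (θ v)
  θ-opposite v with orbit? v o
  ... | yes (c , refl) = trans (cong θ (sym (flip-not c o))) (trans (θ-corner (not c))
    (trans (flip-not c u) (cong opposite (sym (θ-corner c)))))
  ... | no v∉ with w , eq ← σ-L₀ (unit zero) (const true) {zero} refl v =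
    trans (sym (σ-L₀-on (unit zero) (const true) {zero} refl v∉′))
      (trans (eq zero) (cong opposite (trans (sym (eq (suc zero)))
        (σ-L₀-on (unit zero) (const true) {suc zero} refl v∉′))))
    where
    v∉′ : v ∉orbit o
    v∉′ c e = v∉ (c , e)

  θ-flip : ∀ b v → θ (flip b v) ≡ flip b (θ v)
  θ-flip false v = refl
  θ-flip true v = θ-opposite v

  -- Running in every coordinate that reflects onto `v` ensures that the coordinates held constant
  -- are exactly those outside the orbit of `v`.
  through : Point N D → Fin N → Code N D
  through x v j with orbit? (x ! j) v
  ... | yes (c , _) = run c
  ... | no _ = fix (x ! j)

  through-self : ∀ x v → ev (through x v) v ≡ x
  through-self x v = point-ext λ j → trans (ev-! (through x v) v j) (go j)
    where
    go : ∀ j → at (through x v j) v ≡ x ! j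
    go j with orbit? (x ! j) v
    ... | yes (c , eq) = sym eq
    ... | no _ = refl

  through-run : ∀ x i → ∃[ b ] through x (x ! i) i ≡ run b
  through-run x i with orbit? (x ! i) (x ! i)
  ... | yes (c , _) = c , refl
  ... | no out = contradiction (false , refl) out

  θ-code : Code N D → Code N D
  θ-code L i with L i
  ... | fix c = fix (θ c)
  ... | run b = run b

  θ-code-at : ∀ L v i → θ (at (L i) v) ≡ at (θ-code L i) (θ v)
  θ-code-at L v i with L i
  ... | fix c = refl
  ... | run b = θ-flip b v

  interior : Point N D → Fin D → Bool
  interior x i with orbit? (x ! i) o
  ... | yes _ = false
  ... | no _ = true

  interior-∉ : ∀ x i → (x ! i) ∉orbit o → interior x i ≡ true
  interior-∉ x i x∉ with orbit? (x ! i) o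
  ... | yes (c , eq) = contradiction eq (x∉ c)
  ... | no _ = refl

  interior-∈ : ∀ x i c → x ! i ≡ flip c o → interior x i ≡ false
  interior-∈ x i c eq with orbit? (x ! i) o
  ... | yes _ = refl
  ... | no out = contradiction (c , eq) out

  Agrees : Point N D → Set
  Agrees x = ∀ k → σ x ! k ≡ θ (x ! k)

  -- Passing to an end of the line turns the running coordinates, `i` among them, into 0 or n - 1
  -- and leaves the others alone.
  through-count : ∀ x i → (x ! i) ∉orbit o → ∀ c →
    count (interior (ev (through x (x ! i)) (flip c o))) < count (interior x)
  through-count x i x∉ c = count-strict {f = interior y} below i (interior-∉ x i x∉) erased
    where
    L = through x (x ! i)
    y = ev L (flip c o)
    y-at : ∀ k → y ! k ≡ flip c o ⊎ y ! k ≡ opposite (flip c o) ⊎ y ! k ≡ x ! k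
    y-at k with orbit? (x ! k) (x ! i) | ev-! L (flip c o) k
    ... | yes (false , _) | eq = inj₁ eq
    ... | yes (true , _) | eq = inj₂ (inj₁ eq)
    ... | no _ | eq = inj₂ (inj₂ eq)
    below : ∀ k → interior y k ≡ true → interior x k ≡ true
    below k eq with y-at k
    ... | inj₁ y≡ = contradiction (trans (sym eq) (interior-∈ y k c y≡)) λ ()
    ... | inj₂ (inj₁ y≡) = contradiction (trans (sym eq) (interior-∈ y k (not c) (trans y≡ (sym (flip-not c o))))) λ ()
    ... | inj₂ (inj₂ y≡) with orbit? (y ! k) o | orbit? (x ! k) o
    ... | _ | no _ = refl
    ... | no out | yes (c , x≡) = contradiction (c , trans y≡ x≡) out
    erased : interior y i ≡ false
    erased with through-run x i
    ... | b , eq = interior-∈ y i (b xor c) (trans (ev-! L (flip c o) i)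
      (trans (cong (λ D → at D (flip c o)) eq) (flip-xor b c o)))

  -- The images of the two ends fix the image line as `θ-code L`. The parameter of the image of `x`
  -- on it remains unknown, so only the constant coordinates can be read off.
  agrees-off : ∀ x i → (∀ c → Agrees (ev (through x (x ! i)) (flip c o))) →
    ∀ k → (x ! k) ∉orbit (x ! i) → σ x ! k ≡ θ (x ! k)
  agrees-off x i IH k k∉ =
    trans (cong (λ y → σ y ! k) (sym (through-self x (x ! i)))) (trans (proj₂ image k) (value (proj₁ image)))
    where
    L = through x (x ! i)
    ends : ∀ c k → σ (ev L (flip c o)) ! k ≡ at (θ-code L k) (θ (flip c o))
    ends c k = trans (IH c k) (trans (cong θ (ev-! L (flip c o) k)) (θ-code-at L (flip c o) k))
    image : ∃[ w ] (∀ k → σ (ev L (x ! i)) ! k ≡ at (θ-code L k) w)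
    image = image-line σ-pres {L} {θ-code L} (i , through-run x i)
      {b = θ o} {θ (opposite o)} zero≢opposite (ends false) (ends true) (x ! i)
    value : ∀ w → at (θ-code L k) w ≡ θ (x ! k)
    value w with orbit? (x ! k) (x ! i)
    ... | yes (c , eq) = contradiction eq (k∉ c)
    ... | no _ = refl

  -- Two interior coordinates in different orbits pin x down by two lines whose ends are
  -- less interior; otherwise x lies on a corner line.
  agrees′ : ∀ s x → count (interior x) < s → Agrees x
  agrees′ (suc s) x (s≤s x≤s) with all⊎some (λ i → corner⊎interior (x ! i))
    where
    corner⊎interior : ∀ v → (∃[ c ] v ≡ flip c o) ⊎ v ∉orbit o
    corner⊎interior v with orbit? v o
    ... | yes on = inj₁ on
    ... | no out = inj₂ λ c eq → out (c , eq)
  ... | inj₁ on = λ k → trans (cong (λ y → σ y ! k) x≡) (trans (σ-corner β k)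
    (trans (sym (θ-corner (β k))) (cong θ (sym (proj₂ (on k))))))
    where
    β : Fin D → Bool
    β k = proj₁ (on k)
    x≡ : x ≡ corner o β
    x≡ = point-ext λ k → trans (proj₂ (on k)) (sym (corner-! o β k))
  ... | inj₂ (i , i∉) with all⊎some place
    where
    place : ∀ k → (∃₂ λ S c → x ! k ≡ at (if S then run c else fix (flip c o)) (x ! i)) ⊎
      ((x ! k) ∉orbit o × (x ! k) ∉orbit (x ! i))
    place k with orbit? (x ! k) o | orbit? (x ! k) (x ! i)
    ... | yes (c , eq) | _ = inj₁ (false , c , eq)
    ... | no _ | yes (c , eq) = inj₁ (true , c , eq)
    ... | no out | no out′ = inj₂ ((λ c eq → out (c , eq)) , λ c eq → out′ (c , eq))
  ... | inj₁ on = λ k → subst (λ y → σ y ! k ≡ θ (y ! k)) (sym x≡) (σ-cornerLine β S Sᵢ i∉ k)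
    where
    S β : Fin D → Bool
    S k = proj₁ (on k)
    β k = proj₁ (proj₂ (on k))
    x≡ : x ≡ L₀ β S (x ! i)
    x≡ = point-ext λ k → trans (proj₂ (proj₂ (on k))) (sym (ev-! (cornerLine o β S) (x ! i) k))
    Sᵢ : S i ≡ true
    Sᵢ with on i
    ... | true , _ = refl
    ... | false , c , eq = contradiction eq (i∉ c)
  ... | inj₂ (j , j∉ , j∉i) = value
    where
    IH : ∀ i → (x ! i) ∉orbit o → ∀ c → Agrees (ev (through x (x ! i)) (flip c o))
    IH i i∉ c = agrees′ s (ev (through x (x ! i)) (flip c o)) (≤-trans (through-count x i i∉ c) x≤s)
    value : Agrees x
    value k with orbit? (x ! k) (x ! i)
    ... | no out = agrees-off x i (IH i i∉) k λ c eq → out (c , eq)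
    -- This coordinate runs on the line through `i`, but it is constant on the line through `j`
    -- because the two orbits differ.
    ... | yes (c , k≡) = agrees-off x j (IH j j∉) k λ c′ eq →
      j∉i (c′ xor c) (trans (flip-swap c′ eq) (trans (cong (flip c′) k≡) (flip-xor c′ c (x ! i))))

  agrees : ∀ x → Agrees x
  agrees x = agrees′ _ x ≤-refl

-- Line orderings

increasing-≥ : {a : Fin n → Fin n} → StrictlyIncreasing a → ∀ j → toℕ j ≤ toℕ (a j)
increasing-≥ {n} {a} inc j = subst (λ i → toℕ j ≤ toℕ (a i)) (fromℕ<-toℕ j (toℕ<n j)) (go (toℕ j) (toℕ<n j))
  where
  go : ∀ m (m<n : m < n) → m ≤ toℕ (a (fromℕ< m<n))
  go zero m<n = z≤n
  go (suc m) m<n = ≤-<-trans (go m (<⇒≤ m<n)) (inc _ _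
    (subst₂ _<_ (sym (toℕ-fromℕ< (<⇒≤ m<n))) (sym (toℕ-fromℕ< m<n)) ≤-refl))

-- The bound of `increasing-≥` for the conjugate of `a` by the reflection is the reverse bound for
-- `a`.
increasing⇒id : {a : Fin n → Fin n} → StrictlyIncreasing a → ∀ j → a j ≡ j
increasing⇒id {n} {a} inc j = toℕ-injective (≤-antisym (≮⇒≥ λ j<aj →
  <-irrefl refl (≤-<-trans (increasing-≥ {a = opposite ∘ a ∘ opposite} inc′ (opposite j))
    (subst (λ i → opposite (a i) <ᶠ opposite j) (sym (opposite-involutive j)) (opposite-antitone j<aj))))
  (increasing-≥ inc j))
  where
  inc′ : StrictlyIncreasing (opposite ∘ a ∘ opposite)
  inc′ i k i<k = opposite-antitone (inc _ _ (opposite-antitone i<k))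

decreasing⇒opposite : {a : Fin n → Fin n} → StrictlyDecreasing a → ∀ j → a j ≡ opposite j
decreasing⇒opposite {a = a} dec j = trans (sym (opposite-involutive (a j)))
  (cong opposite (increasing⇒id {a = opposite ∘ a} (λ i k i<k → opposite-antitone (dec i k i<k)) j))

ordering⇒line : {q : Fin (suc n) → Point (suc n) d} → IsLineOrdering q → IsLine q
ordering⇒line {n} {d} {q} (_ , mono , i , moves) = L , (i , runs (mono i) moves) , id , id , λ j i → reads (mono i) j
  where
  dir : ∀ {i} → let a = λ j → q j ! i in (StrictlyIncreasing a ⊎ StrictlyDecreasing a) ⊎ Constant a → Dir (suc n)
  dir (inj₁ (inj₁ _)) = run false
  dir (inj₁ (inj₂ _)) = run true
  dir {i} (inj₂ _) = fix (q zero ! i)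
  L : Code (suc n) d
  L i = dir {i} (mono i)
  runs : ∀ {i} m → ¬ Constant (λ j → q j ! i) → ∃[ b ] dir {i} m ≡ run b
  runs (inj₁ (inj₁ _)) _ = false , refl
  runs (inj₁ (inj₂ _)) _ = true , refl
  runs (inj₂ cst) moves = contradiction cst moves
  reads : ∀ {i} m j → q j ! i ≡ at (dir {i} m) j
  reads (inj₁ (inj₁ inc)) j = increasing⇒id inc j
  reads (inj₁ (inj₂ dec)) j = decreasing⇒opposite dec j
  reads (inj₂ cst) j = cst j zero

ev-ordering : (L : Code (suc (suc n)) d) → Moves L → IsLineOrdering (ev L)
ev-ordering {n} {d} L mv@(i , b , Lᵢ) = (λ j k → IsLine-injective (ev-isLine L mv)) , mono , i , moves
  where
  moves : ¬ Constant (λ j → ev L j ! i)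
  moves cst with () ← at-run Lᵢ {zero} {suc zero}
    (trans (sym (ev-! L zero i)) (trans (cst zero (suc zero)) (ev-! L (suc zero) i)))
  mono : ∀ i → let a = λ j → ev L j ! i in (StrictlyIncreasing a ⊎ StrictlyDecreasing a) ⊎ Constant a
  mono i with L i | (λ v → ev-! L v i)
  ... | fix c | eq = inj₂ λ j k → trans (eq j) (sym (eq k))
  ... | run false | eq = inj₁ (inj₁ λ j k j<k → subst₂ _<ᶠ_ (sym (eq j)) (sym (eq k)) j<k)
  ... | run true | eq = inj₁ (inj₂ λ j k j<k → subst₂ _<ᶠ_ (sym (eq k)) (sym (eq j)) (opposite-antitone j<k))

-- `InT` only equates point sets, so the parametrisation of the image is recovered by locating each
-- `σ (ev L v)` in the ordering `q′`.
InT⇒Pres : {σ : Map (suc (suc n)) d} → InT (suc (suc n)) d σ → Pres σ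
InT⇒Pres {n} {d} {σ} ((σ-inj , _) , σ-line) = σ-inj , pres
  where
  pres : ∀ q → IsLine q → IsLine (σ ∘ q)
  pres q (L , mv , θ , θ-inj , q≡) with σ-line (ev L) (ev-ordering L mv)
  ... | q′ , ordering , same with ordering⇒line ordering
  ... | L′ , mv′ , θ′ , θ′-inj , q′≡ = L′ , mv′ , θ′ ∘ index ∘ θ , θ-inj ∘ index-inj ∘ θ′-inj , λ j i →
    trans (cong (λ x → σ x ! i) (point-ext λ k → trans (q≡ j k) (sym (ev-! L (θ j) k))))
      (trans (cong (_! i) (sym (index-eq (θ j)))) (q′≡ (index (θ j)) i))
    where
    hit : ∀ v → ∃[ j ] q′ j ≡ σ (ev L v)
    hit v = Equivalence.to (same (σ (ev L v))) (v , refl)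
    index : Fin (suc (suc n)) → Fin (suc (suc n))
    index v = proj₁ (hit v)
    index-eq : ∀ v → q′ (index v) ≡ σ (ev L v)
    index-eq v = proj₂ (hit v)
    index-inj : Inj index
    index-inj {v} {w} eq = IsLine-injective (ev-isLine L mv)
      (σ-inj (trans (sym (index-eq v)) (trans (cong q′ eq) (index-eq w))))

Pres⇒InT : {σ : Map (suc (suc n)) d} → Pres σ → InT (suc (suc n)) d σ
Pres⇒InT {n} {d} {σ} (σ-inj , σ-line) =
  (σ-inj , λ y → let x , eq = Inj⇒surjective-Map σ σ-inj y in x , λ { refl → eq }) , maps
  where
  maps : MapsLinesToLines σ
  maps q ordering with σ-line q (ordering⇒line ordering)
  ... | L , mv , θ , θ-inj , σ≡ = ev L , ev-ordering L mv , λ p → mk⇔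
    (λ { (j , refl) → θ j , sym (σq j) })
    (λ { (k , refl) → let j , eq = Inj⇒surjective θ θ-inj k in j , trans (σq j) (cong (ev L) eq) })
    where
    σq : ∀ j → σ (q j) ≡ ev L (θ j)
    σq j = point-ext λ i → trans (σ≡ j i) (sym (ev-! L (θ j) i))

-- Signed coordinate permutations followed by a permutation of [n]

Symmetric : (Fin n → Fin n) → Set
Symmetric π = ∀ v → π (opposite v) ≡ opposite (π v)

Symmetric-flip : {π : Fin n → Fin n} → Symmetric π → ∀ b v → π (flip b v) ≡ flip b (π v)
Symmetric-flip π-sym false v = refl
Symmetric-flip π-sym true v = π-sym v

signed : (Fin d → Fin d) → (Fin d → Bool) → (Fin n → Fin n) → Map n d
signed ρ s π x = pt λ k → flip (s k) (π (x ! ρ k))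

signed-! : ∀ ρ s (π : Fin n → Fin n) (x : Point n d) k → signed ρ s π x ! k ≡ flip (s k) (π (x ! ρ k))
signed-! ρ s π x = pt-! _

-- Symmetry lets `π` pass through the reflections, so running coordinates stay running, with `π ∘ θ`
-- as the new parametrisation.
signed-pres : {ρ : Fin d → Fin d} → Inj ρ → ∀ s {π : Fin n → Fin n} → Inj π → Symmetric π → Pres (signed ρ s π)
signed-pres {d} {n} {ρ} ρ-inj s {π} π-inj π-sym = inj , line
  where
  ρ-onto : ∀ k → ∃[ l ] ρ l ≡ k
  ρ-onto = Inj⇒surjective ρ ρ-inj
  inj : Inj (signed ρ s π)
  inj {x} {y} eq = point-ext λ k → let l , ρl = ρ-onto k in subst (λ k → x ! k ≡ y ! k) ρl
    (π-inj (flip-injective (s l) (trans (sym (signed-! ρ s π x l)) (trans (cong (_! l) eq) (signed-! ρ s π y l)))))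
  dir : Bool → Dir n → Dir n
  dir s (fix c) = fix (flip s (π c))
  dir s (run b) = run (s xor b)
  dir-at : ∀ s D v → at (dir s D) (π v) ≡ flip s (π (at D v))
  dir-at s (fix c) v = refl
  dir-at s (run b) v = trans (sym (flip-xor s b (π v))) (cong (flip s) (sym (Symmetric-flip π-sym b v)))
  line : ∀ q → IsLine q → IsLine (signed ρ s π ∘ q)
  line q (L , (i , b , Lᵢ) , θ , θ-inj , q≡) with l , ρl ← ρ-onto i =
    (λ k → dir (s k) (L (ρ k))) , (l , s l xor b , cong (dir (s l)) (trans (cong L ρl) Lᵢ)) ,
    π ∘ θ , θ-inj ∘ π-inj , λ j k → trans (signed-! ρ s π (q j) k)
      (trans (cong (flip (s k) ∘ π) (q≡ j (ρ k))) (sym (dir-at (s k) (L (ρ k)) (θ j))))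

-- Classification of line-preserving maps

classify-by-neighbours : (σ : Map (suc (suc (suc n))) (suc (suc d))) → Pres σ →
  (∀ i → ∃[ k ] Flipped k (σ (corner zero origin)) (σ (corner zero (unit i)))) →
  ∃[ ρ ] Inj ρ × ∃[ s ] s zero ≡ false × ∃[ π ] Inj π × Symmetric π × σ ≗ signed ρ s π
classify-by-neighbours {n} {d} σ σ-pres neighbour =
  ρ , ρ-inj , s , refl , θ , θ-inj , θ-opposite , λ x → point-ext λ k → trans (value x k) (sym (signed-! ρ s θ x k))
  where
  x₀ : Point (suc (suc (suc n))) (suc (suc d))
  x₀ = σ (corner zero origin)
  p : Fin (suc (suc d)) → Fin (suc (suc d))
  p i = proj₁ (neighbour i)
  off : ∀ i j → j ≢ p i → σ (corner zero (unit i)) ! j ≡ x₀ ! j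
  off i = proj₁ (proj₂ (neighbour i))
  on : ∀ i → σ (corner zero (unit i)) ! p i ≡ opposite (x₀ ! p i)
  on i = proj₁ (proj₂ (proj₂ (neighbour i)))
  p-inj : Inj p
  p-inj {i} {k} eq with i ≟ k
  ... | yes i≡k = i≡k
  ... | no i≢k = contradiction corners-equal distinct
    where
    images : ∀ j → σ (corner zero (unit i)) ! j ≡ σ (corner zero (unit k)) ! j
    images j with j ≟ p i
    ... | yes refl = trans (on i) (subst (λ l → opposite (x₀ ! l) ≡ σ (corner zero (unit k)) ! l) (sym eq) (sym (on k)))
    ... | no j≢ = trans (off i j j≢) (sym (off k j λ j≡ → j≢ (trans j≡ (sym eq))))
    corners-equal : corner zero (unit i) ≡ corner zero (unit k)
    corners-equal = proj₁ σ-pres (point-ext images)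
    distinct : corner {suc (suc (suc n))} zero (unit i) ≢ corner zero (unit k)
    distinct eq = zero≢opposite (trans (cong (λ b → flip b zero) (sym (unit-off i≢k)))
      (trans (sym (corner-! zero (unit k) i)) (trans (cong (_! i) (sym eq))
        (trans (corner-! zero (unit i) i) (cong (λ b → flip b zero) (unit-on i))))))
  -- Coordinate 0 of the image corner is the reference value, so the sign of coordinate 0 comes out
  -- positive.
  u : Fin (suc (suc (suc n)))
  u = x₀ ! zero
  orbit : ∀ j → ∃[ c ] x₀ ! j ≡ flip c (x₀ ! p zero)
  orbit = proj₂ (proj₂ (proj₂ (proj₂ (neighbour zero))))
  u≢ū : u ≢ opposite u
  u≢ū eq with orbit zero
  ... | c , eq₀ = proj₁ (proj₂ (proj₂ (proj₂ (neighbour zero)))) (flip-injective c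
    (trans (sym eq₀) (trans eq (trans (cong opposite eq₀) (opposite-flip c _)))))
    where
    opposite-flip : ∀ c (v : Fin (suc (suc (suc n)))) → opposite (flip c v) ≡ flip c (opposite v)
    opposite-flip false v = refl
    opposite-flip true v = refl
  s : Fin (suc (suc d)) → Bool
  s zero = false
  s (suc j) = proj₁ (orbit (suc j)) xor proj₁ (orbit zero)
  x₀-at : ∀ j → x₀ ! j ≡ flip (s j) u
  x₀-at zero = refl
  x₀-at (suc j) = trans (proj₂ (orbit (suc j)))
    (trans (cong (flip (proj₁ (orbit (suc j)))) (flip-swap (proj₁ (orbit zero)) (proj₂ (orbit zero))))
      (flip-xor (proj₁ (orbit (suc j))) (proj₁ (orbit zero)) u))
  -- Undoing the permutation of axes and the signs seen at the origin corner gives a map to which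
  -- `Normalised` applies.
  τ : Map (suc (suc (suc n))) (suc (suc d))
  τ = signed p (s ∘ p) id ∘ σ
  τ-at : ∀ x i → τ x ! i ≡ flip (s (p i)) (σ x ! p i)
  τ-at x i = signed-! p (s ∘ p) id (σ x) i
  τ-pres : Pres τ
  τ-pres = Pres-∘ (signed-pres p-inj (s ∘ p) {id} id (λ v → refl)) σ-pres
  base : ∀ i → flip (s (p i)) (x₀ ! p i) ≡ u
  base i = trans (cong (flip (s (p i))) (x₀-at (p i))) (flip-involutive (s (p i)) u)
  τ-origin : τ (corner zero origin) ≡ corner u origin
  τ-origin = point-ext λ i → trans (τ-at _ i) (trans (base i) (sym (corner-! u origin i)))
  τ-unit : ∀ i → τ (corner zero (unit i)) ≡ corner u (unit i)
  τ-unit i = point-ext λ k → trans (τ-at _ k) (trans (go k) (sym (corner-! u (unit i) k)))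
    where
    go : ∀ k → flip (s (p k)) (σ (corner zero (unit i)) ! p k) ≡ flip (unit i k) u
    go k with k ≟ i
    ... | no k≢i = trans (cong (flip (s (p k))) (off i (p k) (k≢i ∘ p-inj)))
      (trans (base k) (cong (λ b → flip b u) (sym (unit-off k≢i))))
    ... | yes refl = trans (cong (flip (s (p k))) (trans (on k) (cong opposite (x₀-at (p k)))))
      (trans (trans (cong (flip (s (p k))) (sym (flip-not (s (p k)) u))) (trans (flip-xor (s (p k)) (not (s (p k))) u)
        (cong (λ b → flip b u) (xor-not (s (p k)))))) (cong (λ b → flip b u) (sym (unit-on k))))
      where
      xor-not : ∀ b → b xor not b ≡ true
      xor-not false = refl
      xor-not true = refl
  open Normalised τ τ-pres u u≢ū τ-origin τ-unit using (θ; θ-inj; θ-opposite; agrees)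
  p-onto : ∀ k → ∃[ i ] p i ≡ k
  p-onto = Inj⇒surjective p p-inj
  ρ : Fin (suc (suc d)) → Fin (suc (suc d))
  ρ k = proj₁ (p-onto k)
  ρ-inj : Inj ρ
  ρ-inj {k} {l} eq = trans (sym (proj₂ (p-onto k))) (trans (cong p eq) (proj₂ (p-onto l)))
  value : ∀ x k → σ x ! k ≡ flip (s k) (θ (x ! ρ k))
  value x k = subst (λ l → σ x ! l ≡ flip (s l) (θ (x ! ρ k))) (proj₂ (p-onto k))
    (flip-swap (s (p (ρ k))) (trans (sym (agrees x (ρ k))) (τ-at x (ρ k))))

abstract
  classify : (σ : Map (suc (suc (suc n))) (suc (suc d))) → Pres σ →
    ∃[ ρ ] Inj ρ × ∃[ s ] s zero ≡ false × ∃[ π ] Inj π × Symmetric π × σ ≗ signed ρ s π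
  classify σ σ-pres = classify-by-neighbours σ σ-pres λ i →
    adj⇒flipped (adj-pres σ-pres (corner-adj i (unit-on i) λ j → unit-off))

-- Enumerations up to an equivalence

-- `HasSize` with an arbitrary equivalence, so that codes made of functions can be counted up to
-- pointwise equality.
record Enum {A : Set} (_≈_ : A → A → Set) (P : A → Set) (k : ℕ) : Set where
  constructor enum
  field
    elem : Fin k → A
    valid : ∀ i → P (elem i)
    distinct : ∀ i j → elem i ≈ elem j → i ≡ j
    complete : ∀ a → P a → ∃[ i ] elem i ≈ a

enum⇒size : {P : Map n d → Set} → Enum _≗_ P k → HasSize P k
enum⇒size (enum f fP f-inj f-onto) = f , fP , f-inj , f-onto

enum-functions : Enum (_≗_ {A = Fin k} {B = Fin n}) (λ _ → ⊤) (n ^ k)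
enum-functions {k} {n} = enum finToFun _
  (λ c c′ eq → trans (sym (funToFin-finToFin {k} c)) (trans (funToFin-cong eq) (funToFin-finToFin {k} c′)))
  λ f _ → funToFin f , finToFun-funToFin f

enum-subset : {Q : Fin k → Set} → (∀ i → Dec (Q i)) → ∃[ l ] Enum _≡_ Q l
enum-subset {zero} Q? = 0 , enum (λ ()) (λ ()) (λ ()) λ ()
enum-subset {suc k} Q? with Q? zero | enum-subset (Q? ∘ suc)
... | no ¬q | l , enum f fQ f-inj f-onto = l , enum (suc ∘ f) fQ (λ i j → f-inj i j ∘ suc-injective) λ
  { zero q → contradiction q ¬q
  ; (suc x) q → let i , eq = f-onto x q in i , cong suc eq }
... | yes q | l , enum f fQ f-inj f-onto = suc l , enum g gQ g-inj λ
  { zero _ → zero , refl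
  ; (suc x) q → let i , eq = f-onto x q in suc i , cong suc eq }
  where
  g : Fin (suc l) → Fin (suc k)
  g zero = zero
  g (suc i) = suc (f i)
  gQ : ∀ i → _
  gQ zero = q
  gQ (suc i) = fQ i
  g-inj : ∀ i j → g i ≡ g j → i ≡ j
  g-inj zero zero _ = refl
  g-inj (suc i) (suc j) eq = cong suc (f-inj i j (suc-injective eq))

enum-filter : {_≈_ : A → A → Set} {P Q : A → Set} → Enum _≈_ P k → (∀ a → P a) → (∀ a → Dec (Q a)) →
  (∀ {a b} → a ≈ b → Q b → Q a) → ∃[ l ] Enum _≈_ Q l
enum-filter {_≈_ = _≈_} (enum f fP f-inj f-onto) total Q? Q-resp with enum-subset (Q? ∘ f)
... | l , enum g gQ g-inj g-onto = l , enum (f ∘ g) gQ (λ i j → g-inj i j ∘ f-inj _ _)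
  λ a q → let i , fi≈a = f-onto a (total a) ; j , gj≡i = g-onto i (Q-resp fi≈a q)
          in j , subst (λ i → f i ≈ a) (sym gj≡i) fi≈a

enum-× : {_≈_ : A → A → Set} {_≈′_ : B → B → Set} {P : A → Set} {Q : B → Set} {l : ℕ} →
  Enum _≈_ P k → Enum _≈′_ Q l →
  Enum (λ x y → proj₁ x ≈ proj₁ y × proj₂ x ≈′ proj₂ y) (λ x → P (proj₁ x) × Q (proj₂ x)) (k * l)
enum-× {k = k} {_≈_ = _≈_} {_≈′_} {l = l} (enum f fP f-inj f-onto) (enum g gQ g-inj g-onto) = enum
  (λ c → f (fst c) , g (snd c)) (λ c → fP (fst c) , gQ (snd c))
  (λ c c′ (eq , eq′) → trans (sym (combine-remQuot {k} l c)) (trans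
    (cong₂ combine (f-inj _ _ eq) (g-inj _ _ eq′)) (combine-remQuot {k} l c′)))
  λ (a , b) (p , q) → let i , fi≈a = f-onto a p ; j , gj≈b = g-onto b q in
    combine i j , subst (λ ij → f (proj₁ ij) ≈ a × g (proj₂ ij) ≈′ b) (sym (remQuot-combine i j)) (fi≈a , gj≈b)
  where
  fst : Fin (k * l) → Fin k
  fst c = proj₁ (remQuot {k} l c)
  snd : Fin (k * l) → Fin l
  snd c = proj₂ (remQuot {k} l c)

-- `_~_` is a one-to-one correspondence up to the two equivalences. A relation is convenient where
-- partners are found by a search, as for rotations with a prescribed record.
enum-transfer : {_≈_ : A → A → Set} {_≈′_ : B → B → Set} {P : A → Set} {Q : B → Set} (_~_ : A → B → Set) →
  (∀ {a} → P a → ∃[ b ] Q b × a ~ b) → (∀ {b} → Q b → ∃[ a ] P a × a ~ b) →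
  (∀ {a a′ b b′} → P a → P a′ → a ~ b → a′ ~ b′ → b ≈′ b′ → a ≈ a′) →
  (∀ {a a′ b b′} → a ~ b → a′ ~ b′ → a ≈ a′ → b ≈′ b′) →
  Enum _≈_ P k → Enum _≈′_ Q k
enum-transfer _~_ to from injective functional (enum f fP f-inj f-onto) = enum
  (λ i → proj₁ (to (fP i))) (λ i → proj₁ (proj₂ (to (fP i))))
  (λ i j eq → f-inj i j (injective (fP i) (fP j) (proj₂ (proj₂ (to (fP i)))) (proj₂ (proj₂ (to (fP j)))) eq))
  λ b q → let a , p , a~b = from q ; i , fi≈a = f-onto a p
          in i , functional (proj₂ (proj₂ (to (fP i)))) a~b fi≈a

inj? : (f : Fin k → Fin n) → Dec (Inj f)
inj? f = map′ (λ h {x} {y} → h x y) (λ h x y → h {x} {y})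
  (all? λ x → all? λ y → (f x ≟ f y) →-dec (x ≟ y))

Inj-resp : {f g : Fin k → Fin n} → f ≗ g → Inj g → Inj f
Inj-resp f≗g g-inj {x} {y} eq = g-inj (trans (sym (f≗g x)) (trans eq (f≗g y)))

enum-bits : Enum (_≗_ {A = Fin k}) (λ (s : Fin k → Bool) → ⊤) (2 ^ k)
enum-bits {k} = enum-transfer (λ c s → ∀ i → s i ≡ bit (c i))
  (λ {c} _ → bit ∘ c , _ , λ i → refl) (λ {s} _ → digit ∘ s , _ , λ i → sym (bit-digit (s i)))
  (λ _ _ c~s c′~s′ s≗s′ i → bit-inj _ _ (trans (sym (c~s i)) (trans (s≗s′ i) (c′~s′ i))))
  (λ c~s c′~s′ c≗c′ i → trans (c~s i) (trans (cong bit (c≗c′ i)) (sym (c′~s′ i))))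
  (enum-functions {k} {2})
  where
  bit : Fin 2 → Bool
  bit zero = false
  bit (suc zero) = true
  digit : Bool → Fin 2
  digit false = zero
  digit true = suc zero
  bit-digit : ∀ b → bit (digit b) ≡ b
  bit-digit false = refl
  bit-digit true = refl
  bit-inj : ∀ c c′ → bit c ≡ bit c′ → c ≡ c′
  bit-inj zero zero _ = refl
  bit-inj zero (suc zero) ()
  bit-inj (suc zero) zero ()
  bit-inj (suc zero) (suc zero) _ = refl

-- Counting codes, symmetric permutations and line-preserving maps

Signs : ℕ → Set
Signs d = (Fin d → Fin d) × (Fin d → Bool)

_≈ˢ_ : Signs d → Signs d → Set
(ρ , s) ≈ˢ (ρ′ , s′) = ρ ≗ ρ′ × s ≗ s′

PositiveAt₀ : Signs (suc d) → Set
PositiveAt₀ (ρ , s) = Inj ρ × s zero ≡ false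

enum-signs : ∃[ r ] Enum _≈ˢ_ (PositiveAt₀ {d}) r
enum-signs {d} = enum-filter (enum-× (enum-functions {suc d}) enum-bits) _
  (λ (ρ , s) → inj? ρ ×-dec (s zero ≟ᵇ false))
  (λ (ρ≗ , s≗) (ρ-inj , s₀) → Inj-resp ρ≗ ρ-inj , trans (s≗ zero) s₀)

InjSym : (Fin n → Fin n) → Set
InjSym π = Inj π × Symmetric π

enum-symmetric : ∃[ f ] Enum _≗_ (InjSym {n}) f
enum-symmetric {n} = enum-filter (enum-functions {n} {n}) _
  (λ π → inj? π ×-dec all? λ v → π (opposite v) ≟ opposite (π v))
  (λ π≗ (π-inj , π-sym) → Inj-resp π≗ π-inj ,
    λ v → trans (π≗ (opposite v)) (trans (π-sym v) (cong opposite (sym (π≗ v)))))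

size-F : ∀ {f} → Enum _≗_ (InjSym {n}) f → Enum _≗_ (InF n (suc d)) f
size-F {n} {d} = enum-transfer (λ π σ → σ ≗ map π)
  (λ {π} (π-inj , π-sym) → map π ,
    (π , (π-inj , λ v → let w , eq = Inj⇒surjective π π-inj v in w , λ { refl → eq }) , π-sym , λ x → refl) , λ x → refl)
  (λ { (π , (π-inj , _) , π-sym , σ≗) → π , (π-inj , π-sym) , σ≗ })
  (λ {π} {π′} _ _ σ≗ σ′≗ eq v → let x = pt {suc d} (const v) in
    subst (λ w → π w ≡ π′ w) (pt-! (const v) zero) (trans (sym (lookup-map zero π x))
      (trans (cong (_! zero) (trans (sym (σ≗ x)) (trans (eq x) (σ′≗ x)))) (lookup-map zero π′ x))))
  (λ {π} {π′} σ≗ σ′≗ eq x → trans (σ≗ x) (trans (map-cong eq x) (sym (σ′≗ x))))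

-- If the two source coordinates differed, changing only coordinate `ρ k` from 0 to 1 would alter
-- the left side and not the right.
signed-unique-ρ : ∀ {ρ ρ′ : Fin d → Fin d} {s s′} {π π′ : Fin (suc (suc n)) → Fin (suc (suc n))} → Inj π →
  signed ρ s π ≗ signed ρ′ s′ π′ → ρ ≗ ρ′
signed-unique-ρ {d} {n} {ρ} {ρ′} {s} {s′} {π} {π′} π-inj eq k with ρ k ≟ ρ′ k
... | yes same = same
... | no differ = contradiction (π-inj (flip-injective (s k) (begin
  flip (s k) (π zero)           ≡⟨ cong (flip (s k) ∘ π) (pt-! (const zero) (ρ k)) ⟨
  flip (s k) (π (x ! ρ k))      ≡⟨ values x ⟩
  flip (s′ k) (π′ (x ! ρ′ k))   ≡⟨ cong (flip (s′ k) ∘ π′) (trans (pt-! (const zero) (ρ′ k)) (sym (trans (pt-! _ (ρ′ k)) (updateAt-minimal (ρ′ k) (ρ k) (const zero) (differ ∘ sym))))) ⟩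
  flip (s′ k) (π′ (y ! ρ′ k))   ≡⟨ values y ⟨
  flip (s k) (π (y ! ρ k))      ≡⟨ cong (flip (s k) ∘ π) (trans (pt-! _ (ρ k)) (updateAt-updates (ρ k) (const zero))) ⟩
  flip (s k) (π (suc zero))     ∎))) λ ()
  where
  open ≡-Reasoning
  x y : Point (suc (suc n)) d
  x = pt (const zero)
  y = pt (updateAt (const zero) (ρ k) (const (suc zero)))
  values : ∀ x → flip (s k) (π (x ! ρ k)) ≡ flip (s′ k) (π′ (x ! ρ′ k))
  values x = trans (sym (signed-! ρ s π x k)) (trans (cong (_! k) (eq x)) (signed-! ρ′ s′ π′ x k))

signed-values : ∀ {ρ ρ′ : Fin d → Fin d} {s s′} {π π′ : Fin n → Fin n} →
  signed ρ s π ≗ signed ρ′ s′ π′ → ∀ k v → flip (s k) (π v) ≡ flip (s′ k) (π′ v)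
signed-values {ρ = ρ} {ρ′} {s} {s′} {π} {π′} eq k v =
  subst₂ (λ w w′ → flip (s k) (π w) ≡ flip (s′ k) (π′ w′)) (pt-! (const v) (ρ k)) (pt-! (const v) (ρ′ k))
    (trans (sym (signed-! ρ s π (pt (const v)) k)) (trans (cong (_! k) (eq (pt (const v)))) (signed-! ρ′ s′ π′ (pt (const v)) k)))

-- Different signs at `k` would make the images of 0 and 1 both fixed by the reflection, but only
-- the centre is.
signed-unique-s : ∀ {ρ ρ′ : Fin d → Fin d} {s s′} {π π′ : Fin (suc (suc n)) → Fin (suc (suc n))} → Inj π →
  π ≗ π′ → signed ρ s π ≗ signed ρ′ s′ π′ → s ≗ s′
signed-unique-s {n = n} {ρ} {ρ′} {s} {s′} {π} {π′} π-inj π≗ eq k with bit-cases (s k) (s′ k)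
... | inj₁ same = sym same
... | inj₂ differ = contradiction (π-inj (flip-injective (s k)
  (opposite-fixed-unique (fixed zero) (fixed (suc zero))))) λ ()
  where
  fixed : ∀ v → opposite (flip (s k) (π v)) ≡ flip (s k) (π v)
  fixed v = trans (sym (flip-not (s k) (π v))) (trans (cong (λ b → flip b (π v)) (sym differ))
    (trans (cong (flip (s′ k)) (π≗ v)) (sym (signed-values {ρ = ρ} {ρ′} {s} {s′} {π} {π′} eq k v))))

signed-cong : ∀ {ρ ρ′ : Fin d → Fin d} {s s′} {π π′ : Fin n → Fin n} →
  ρ ≗ ρ′ → s ≗ s′ → π ≗ π′ → signed ρ s π ≗ signed ρ′ s′ π′
signed-cong {ρ = ρ} {ρ′} {s} {s′} {π} {π′} ρ≗ s≗ π≗ x = point-ext λ k → trans (signed-! ρ s π x k)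
  (trans (cong₂ flip (s≗ k) (trans (π≗ _) (cong (λ l → π′ (x ! l)) (ρ≗ k)))) (sym (signed-! ρ′ s′ π′ x k)))

size-T : ∀ {r f} → Enum _≈ˢ_ (PositiveAt₀ {suc d}) r → Enum _≗_ (InjSym {suc (suc (suc n))}) f →
  Enum _≗_ (InT (suc (suc (suc n))) (suc (suc d))) (r * f)
size-T {d} {n} signs symmetric = enum-transfer (λ ((ρ , s) , π) σ → σ ≗ signed ρ s π)
  (λ { {(ρ , s) , π} ((ρ-inj , s₀) , π-inj , π-sym) →
    signed ρ s π , Pres⇒InT (signed-pres ρ-inj s π-inj π-sym) , λ x → refl })
  (λ {σ} → code σ)
  (λ { {(ρ , s) , π} {(ρ′ , s′) , π′} ((_ , s₀) , π-inj , _) ((_ , s₀′) , _) σ≗ σ′≗ eq →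
    unique ρ ρ′ s s′ π π′ s₀ s₀′ π-inj (λ x → trans (sym (σ≗ x)) (trans (eq x) (σ′≗ x))) })
  (λ { σ≗ σ′≗ ((ρ≗ , s≗) , π≗) x → trans (σ≗ x) (trans (signed-cong ρ≗ s≗ π≗ x) (sym (σ′≗ x))) })
  (enum-× signs symmetric)
  where
  code : ∀ σ → InT (suc (suc (suc n))) (suc (suc d)) σ →
    Σ[ ((ρ , s) , π) ∈ Signs (suc (suc d)) × (Fin (suc (suc (suc n))) → Fin (suc (suc (suc n)))) ]
      (PositiveAt₀ (ρ , s) × InjSym π) × σ ≗ signed ρ s π
  code σ inT with classify σ (InT⇒Pres inT)
  ... | ρ , ρ-inj , s , s₀ , π , π-inj , π-sym , σ≗ = ((ρ , s) , π) , ((ρ-inj , s₀) , π-inj , π-sym) , σ≗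
  unique : ∀ ρ ρ′ (s s′ : Fin (suc (suc d)) → Bool) (π π′ : Fin (suc (suc (suc n))) → Fin (suc (suc (suc n)))) →
    s zero ≡ false → s′ zero ≡ false → Inj π → signed ρ s π ≗ signed ρ′ s′ π′ → (ρ ≗ ρ′ × s ≗ s′) × π ≗ π′
  unique ρ ρ′ s s′ π π′ s₀ s₀′ π-inj eq = (signed-unique-ρ {s = s} {s′} {π} {π′} π-inj eq , signed-unique-s {ρ = ρ} {ρ′} {s} {s′} π-inj π≗ eq) , π≗
    where
    π≗ : π ≗ π′
    -- Both signs at coordinate 0 are positive, so there the two permutations can be compared
    -- directly.
    π≗ v = subst₂ (λ b b′ → flip b (π v) ≡ flip b′ (π′ v)) s₀ s₀′ (signed-values {ρ = ρ} {ρ′} {s} {s′} eq zero v)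

open xor-∧-Solver using (solve; con; _:+_; _:=_)

-- Determinants of signed permutations

parity : (Fin k → Bool) → Bool
parity {zero} f = false
parity {suc k} f = f zero xor parity (f ∘ suc)

parity-cong : {f g : Fin k → Bool} → f ≗ g → parity f ≡ parity g
parity-cong {zero} f≗g = refl
parity-cong {suc k} f≗g = cong₂ _xor_ (f≗g zero) (parity-cong (f≗g ∘ suc))

parity-update : ∀ {f g : Fin k → Bool} i → (∀ j → j ≢ i → g j ≡ f j) → parity g ≡ parity f xor (f i xor g i)
parity-update {suc k} {f} {g} zero off = trans
  (cong (g zero xor_) (parity-cong λ j → off (suc j) λ ()))
  (solve 3 (λ f₀ g₀ p → g₀ :+ p := (f₀ :+ p) :+ (f₀ :+ g₀)) refl (f zero) (g zero) (parity (f ∘ suc)))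
parity-update {suc k} {f} {g} (suc i) off = trans
  (cong₂ _xor_ (off zero λ ()) (parity-update {k} {f ∘ suc} {g ∘ suc} i λ j j≢i → off (suc j) (j≢i ∘ suc-injective)))
  (sym (xor-assoc (f zero) (parity (f ∘ suc)) (f (suc i) xor g (suc i))))

parity-update₂ : ∀ {f g : Fin k → Bool} {i j} → i ≢ j → (∀ l → l ≢ i → l ≢ j → g l ≡ f l) →
  parity g ≡ parity f xor ((f i xor g i) xor (f j xor g j))
parity-update₂ {k} {f} {g} {i} {j} i≢j off = begin
  parity g                                            ≡⟨ parity-update j g-off ⟩
  parity h xor (h j xor g j)                          ≡⟨ cong₂ (λ p b → p xor (b xor g j)) (parity-update i h-off) hⱼ ⟩
  (parity f xor (f i xor h i)) xor (f j xor g j)      ≡⟨ cong (λ b → (parity f xor (f i xor b)) xor (f j xor g j)) hᵢ ⟩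
  (parity f xor (f i xor g i)) xor (f j xor g j)      ≡⟨ xor-assoc (parity f) (f i xor g i) (f j xor g j) ⟩
  parity f xor ((f i xor g i) xor (f j xor g j))      ∎
  where
  open ≡-Reasoning
  h : Fin k → Bool
  h = updateAt f i (const (g i))
  hᵢ : h i ≡ g i
  hᵢ = updateAt-updates i f
  h-off : ∀ l → l ≢ i → h l ≡ f l
  h-off l = updateAt-minimal l i f
  hⱼ : h j ≡ f j
  hⱼ = h-off j (i≢j ∘ sym)
  g-off : ∀ l → l ≢ j → g l ≡ h l
  g-off l l≢j with l ≟ i
  ... | yes refl = sym hᵢ
  ... | no l≢i = trans (off l l≢i l≢j) (sym (h-off l l≢i))

lt : Fin n → Fin n → Bool
lt a b = does (toℕ a <? toℕ b)

lt-flip : {a b : Fin n} → a ≢ b → lt b a ≡ not (lt a b)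
lt-flip {a = a} {b} a≢b with <-cmp (toℕ a) (toℕ b)
... | tri< a<b _ b≮a = trans (dec-false (toℕ b <? toℕ a) b≮a) (cong not (sym (dec-true (toℕ a <? toℕ b) a<b)))
... | tri≈ _ a≡b _ = contradiction (toℕ-injective a≡b) a≢b
... | tri> a≮b _ b<a = trans (dec-true (toℕ b <? toℕ a) b<a) (cong not (sym (dec-false (toℕ a <? toℕ b) a≮b)))

-- The parity of the number of inversions, which is the sign when `f` is a permutation. The codomain
-- is separate from the domain so that tails of `f` are covered.
inversions : (Fin k → Fin n) → Bool
inversions {zero} f = false
inversions {suc k} f = parity (λ l → lt (f (suc l)) (f zero)) xor inversions (f ∘ suc)

inversions-cong : {f g : Fin k → Fin n} → f ≗ g → inversions f ≡ inversions g
inversions-cong {zero} f≗g = refl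
inversions-cong {suc k} f≗g = cong₂ _xor_
  (parity-cong λ l → cong₂ lt (f≗g (suc l)) (f≗g zero)) (inversions-cong (f≗g ∘ suc))

record Swapped (i j : Fin k) (f g : Fin k → A) : Set where
  constructor swapped
  field
    atᵢ : g i ≡ f j
    atⱼ : g j ≡ f i
    off : ∀ l → l ≢ i → l ≢ j → g l ≡ f l

Swapped-sym : {i j : Fin k} {f g : Fin k → A} → Swapped i j f g → Swapped j i f g
Swapped-sym (swapped gᵢ gⱼ off) = swapped gⱼ gᵢ λ l l≢j l≢i → off l l≢i l≢j

parity-swap : ∀ {f g : Fin k → Bool} {i j} → i ≢ j → Swapped i j f g → parity g ≡ parity f
parity-swap {f = f} {g} {i} {j} i≢j (swapped gᵢ gⱼ off) = trans (parity-update₂ i≢j off)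
  (trans (cong₂ (λ a b → parity f xor ((f i xor a) xor (f j xor b))) gᵢ gⱼ)
    (solve 3 (λ p a b → p :+ ((a :+ b) :+ (b :+ a)) := p) refl (parity f) (f i) (f j)))

-- Induction on the distance. A swap of neighbours reverses a single pair. Otherwise position 1 is
-- dropped: the pairs involving its value `m` have the same total parity before and after, and what
-- remains is a closer swap.
inversions-swap-head : ∀ {f g : Fin (suc k) → Fin n} j → Inj f → Swapped zero (suc j) f g →
  inversions g ≡ not (inversions f)
inversions-swap-head {suc k} {f = f} {g} zero f-inj (swapped g₀ g₁ off) = begin
  (lt (g (suc zero)) (g zero) xor parity (λ l → lt (gᵗ l) (g zero))) xor
    (parity (λ l → lt (gᵗ l) (g (suc zero))) xor inversions gᵗ)
      ≡⟨ cong₂ _xor_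
          (cong₂ _xor_ (trans (cong₂ lt g₁ g₀) (lt-flip λ eq → contradiction (f-inj eq) λ ()))
            (parity-cong λ l → cong₂ lt (tail l) g₀))
          (cong₂ _xor_ (parity-cong λ l → cong₂ lt (tail l) g₁) (inversions-cong tail)) ⟩
  (not a xor p₁) xor (p₀ xor r)
      ≡⟨ solve 4 (λ a p₀ p₁ r → ((con true :+ a) :+ p₁) :+ (p₀ :+ r) := con true :+ ((a :+ p₀) :+ (p₁ :+ r))) refl a p₀ p₁ r ⟩
  not ((a xor p₀) xor (p₁ xor r)) ∎
  where
  open ≡-Reasoning
  fᵗ = λ l → f (suc (suc l))
  gᵗ = λ l → g (suc (suc l))
  tail : ∀ l → gᵗ l ≡ fᵗ l
  tail l = off (suc (suc l)) (λ ()) λ ()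
  a = lt (f (suc zero)) (f zero)
  p₀ = parity λ l → lt (fᵗ l) (f zero)
  p₁ = parity λ l → lt (fᵗ l) (f (suc zero))
  r = inversions fᵗ
inversions-swap-head {suc k} {n} {f} {g} (suc j) f-inj (swapped g₀ gⱼ off) = begin
  (lt (g (suc zero)) (g zero) xor p′) xor (parity (λ l → lt (gᵗ l) (g (suc zero))) xor r′)
      ≡⟨ cong₂ (λ x y → (x xor p′) xor (y xor r′)) (cong₂ lt g₁ g₀) middle ⟩
  (lt m y xor p′) xor ((q xor (lt y m xor lt x m)) xor r′)
      ≡⟨ cong₂ (λ a b → (lt m y xor p′) xor ((q xor (a xor b)) xor r′)) (lt-flip λ eq → contradiction (f-inj eq) λ ())
          (lt-flip λ eq → contradiction (f-inj eq) λ ()) ⟩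
  (lt m y xor p′) xor ((q xor (not (lt m y) xor not (lt m x))) xor r′)
      ≡⟨ solve 5 (λ a b q p r → (b :+ p) :+ ((q :+ ((con true :+ b) :+ (con true :+ a))) :+ r) := (a :+ q) :+ (p :+ r)) refl
          (lt m x) (lt m y) q p′ r′ ⟩
  (lt m x xor q) xor (p′ xor r′)
      ≡⟨ cong ((lt m x xor q) xor_) IH ⟩
  (lt m x xor q) xor not (p xor r)
      ≡⟨ solve 4 (λ a q p r → (a :+ q) :+ (con true :+ (p :+ r)) := con true :+ ((a :+ p) :+ (q :+ r))) refl (lt m x) q p r ⟩
  not ((lt m x xor p) xor (q xor r)) ∎
  where
  open ≡-Reasoning
  fᵗ gᵗ : Fin k → Fin n
  fᵗ l = f (suc (suc l))
  gᵗ l = g (suc (suc l))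
  x = f zero
  m = f (suc zero)
  y = fᵗ j
  g₁ : g (suc zero) ≡ m
  g₁ = off (suc zero) (λ ()) λ ()
  tail : ∀ l → l ≢ j → gᵗ l ≡ fᵗ l
  tail l l≢j = off (suc (suc l)) (λ ()) (l≢j ∘ suc-injective ∘ suc-injective)
  q = parity λ l → lt (fᵗ l) m
  p = parity λ l → lt (fᵗ l) x
  r = inversions fᵗ
  p′ = parity λ l → lt (gᵗ l) (g zero)
  r′ = inversions gᵗ
  middle : parity (λ l → lt (gᵗ l) (g (suc zero))) ≡ q xor (lt y m xor lt x m)
  middle = trans (parity-cong λ l → cong (lt (gᵗ l)) g₁)
    (trans (parity-update j λ l l≢j → cong (λ v → lt v m) (tail l l≢j))
      (cong (λ v → q xor (lt y m xor lt v m)) gⱼ))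
  drop : (Fin (suc (suc k)) → Fin n) → Fin (suc k) → Fin n
  drop h zero = h zero
  drop h (suc l) = h (suc (suc l))
  drop-inj : Inj (drop f)
  drop-inj {zero} {zero} _ = refl
  drop-inj {zero} {suc l} eq with () ← f-inj eq
  drop-inj {suc l} {zero} eq with () ← f-inj eq
  drop-inj {suc l} {suc l′} eq = suc-injective (f-inj eq)
  drop-swapped : Swapped zero (suc j) (drop f) (drop g)
  drop-swapped = swapped g₀ gⱼ λ
    { zero z≢z _ → contradiction refl z≢z ; (suc l) _ l≢j → tail l (l≢j ∘ cong suc) }
  IH : p′ xor r′ ≡ not (p xor r)
  IH = inversions-swap-head j drop-inj drop-swapped

inversions-swap : ∀ {f g : Fin k → Fin n} {i j} → i ≢ j → Inj f → Swapped i j f g → inversions g ≡ not (inversions f)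
inversions-swap {i = zero} {zero} i≢j _ _ = contradiction refl i≢j
inversions-swap {i = zero} {suc j} _ f-inj sw = inversions-swap-head j f-inj sw
inversions-swap {i = suc i} {zero} _ f-inj sw = inversions-swap-head i f-inj (Swapped-sym sw)
inversions-swap {suc k} {f = f} {g} {suc i} {suc j} i≢j f-inj (swapped gᵢ gⱼ off) = trans
  (cong₂ _xor_ (trans (parity-cong λ l → cong (lt (g (suc l))) g₀) (parity-swap i′≢j′
      (swapped (cong (λ v → lt v (f zero)) gᵢ) (cong (λ v → lt v (f zero)) gⱼ)
        λ l l≢i l≢j → cong (λ v → lt v (f zero)) (tail l l≢i l≢j))))
    (inversions-swap {f = f ∘ suc} {g ∘ suc} i′≢j′ (suc-injective ∘ f-inj) (swapped gᵢ gⱼ tail)))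
  (sym (not-distribʳ-xor (parity (λ l → lt (f (suc l)) (f zero))) (inversions (f ∘ suc))))
  where
  i′≢j′ : i ≢ j
  i′≢j′ = i≢j ∘ cong suc
  g₀ : g zero ≡ f zero
  g₀ = off zero (λ ()) λ ()
  tail : ∀ l → l ≢ i → l ≢ j → g (suc l) ≡ f (suc l)
  tail l l≢i l≢j = off (suc l) (l≢i ∘ suc-injective) (l≢j ∘ suc-injective)

-- The determinant of the signed permutation matrix, with false for +1.
det : (Fin d → Fin d) → (Fin d → Bool) → Bool
det ρ s = inversions ρ xor parity s

-- The determinant of the identity, left unevaluated: being proper means agreeing with it.
det₀ : ∀ d → Bool
det₀ d = det {d} id (const false)

record Rotated (i j : Fin d) (s s′ : Fin d → Bool) : Set where
  constructor rotated
  field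
    atᵢ : s′ i ≡ not (s j)
    atⱼ : s′ j ≡ s i
    off : ∀ l → l ≢ i → l ≢ j → s′ l ≡ s l

-- The transposition and the single added negation each change the sign of the determinant.
det-rotate : ∀ {ρ ρ′ : Fin d → Fin d} {s s′ i j} → i ≢ j → Inj ρ → Swapped i j ρ ρ′ → Rotated i j s s′ →
  det ρ′ s′ ≡ det ρ s
det-rotate {ρ = ρ} {ρ′} {s} {s′} {i} {j} i≢j ρ-inj sw (rotated s′ᵢ s′ⱼ off) = trans
  (cong₂ _xor_ (inversions-swap i≢j ρ-inj sw) (trans (parity-update₂ i≢j off)
    (cong₂ (λ a b → parity s xor ((s i xor a) xor (s j xor b))) s′ᵢ s′ⱼ)))
  (solve 4 (λ v p a b → (con true :+ v) :+ (p :+ ((a :+ (con true :+ b)) :+ (b :+ a))) := v :+ p) refl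
    (inversions ρ) (parity s) (s i) (s j))

-- Rotations

record Reached (n : ℕ) (g : Map n d) (ρ : Fin d → Fin d) (s : Fin d → Bool) : Set where
  constructor reached
  field
    member : InR n d g
    injective : Inj ρ
    proper : det ρ s ≡ det₀ d
    acts : g ≗ signed ρ s id

Swapped-inj : {i j : Fin d} {ρ ρ′ : Fin d → Fin d} → Inj ρ → Swapped i j ρ ρ′ → Inj ρ′
Swapped-inj {d} {i} {j} {ρ} {ρ′} ρ-inj (swapped ρ′ᵢ ρ′ⱼ off) {x} {y} eq =
  τ-inj x y (ρ-inj (trans (sym (value x)) (trans eq (value y))))
  where
  τ : Fin d → Fin d
  τ l with l ≟ i | l ≟ j
  ... | yes _ | _ = j
  ... | no _ | yes _ = i
  ... | no _ | no _ = l
  value : ∀ l → ρ′ l ≡ ρ (τ l)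
  value l with l ≟ i | l ≟ j
  ... | yes refl | _ = ρ′ᵢ
  ... | no _ | yes refl = ρ′ⱼ
  ... | no l≢i | no l≢j = off l l≢i l≢j
  τ-inj : ∀ x y → τ x ≡ τ y → x ≡ y
  τ-inj x y eq with x ≟ i | x ≟ j | y ≟ i | y ≟ j
  ... | yes x≡ | _ | yes y≡ | _ = trans x≡ (sym y≡)
  ... | yes x≡ | _ | no y≢ | yes y≡ = contradiction (trans y≡ eq) y≢
  ... | yes x≡ | _ | no _ | no y≢ = contradiction (sym eq) y≢
  ... | no x≢ | yes x≡ | yes y≡ | _ = contradiction (trans x≡ (sym eq)) x≢
  ... | no _ | yes x≡ | no _ | yes y≡ = trans x≡ (sym y≡)
  ... | no _ | yes x≡ | no y≢ | no _ = contradiction (sym eq) y≢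
  ... | no _ | no x≢ | yes _ | _ = contradiction eq x≢
  ... | no x≢ | no _ | no _ | yes _ = contradiction eq x≢
  ... | no _ | no _ | no _ | no _ = eq

R-on₁ : ∀ {i j : Fin d} → i ≢ j → (x : Point n d) → R i j x ! i ≡ opposite (x ! j)
R-on₁ {i = i} {j} i≢j x = trans (lookup∘update′ i≢j (x [ i ]≔ opposite (x ! j)) (x ! i)) (lookup∘update i x (opposite (x ! j)))

R-on₂ : ∀ (i j : Fin d) (x : Point n d) → R i j x ! j ≡ x ! i
R-on₂ i j x = lookup∘update j (x [ i ]≔ opposite (x ! j)) (x ! i)

R-off : ∀ {i j l : Fin d} → l ≢ i → l ≢ j → (x : Point n d) → R i j x ! l ≡ x ! l
R-off {i = i} {j} l≢i l≢j x = trans (lookup∘update′ l≢j (x [ i ]≔ opposite (x ! j)) (x ! i)) (lookup∘update′ l≢i x (opposite (x ! j)))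

reached-id : Reached {d} n id id (const false)
reached-id = reached R-id id refl λ x → point-ext λ k → sym (signed-! id (const false) id x k)

-- Stated for any `ρ′` and `s′` related to the old data, rather than for `swap` and `rotate`, so
-- that two steps can lead back to `ρ` itself.
reached-step : ∀ {g : Map n d} {ρ ρ′ s s′ i j} → i ≢ j → Reached n g ρ s → Swapped i j ρ ρ′ → Rotated i j s s′ →
  Reached n (R i j ∘ g) ρ′ s′
reached-step {n} {d} {g} {ρ} {ρ′} {s} {s′} {i} {j} i≢j (reached g∈R ρ-inj proper acts) sw@(swapped ρ′ᵢ ρ′ⱼ ρ-off) rot@(rotated s′ᵢ s′ⱼ s-off) =
  reached (R-step i j i≢j g g∈R) (Swapped-inj ρ-inj sw) (trans (det-rotate i≢j ρ-inj sw rot) proper)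
    λ x → point-ext λ l → trans (value x l) (sym (signed-! ρ′ s′ id x l))
  where
  g-at : ∀ x l → g x ! l ≡ flip (s l) (x ! ρ l)
  g-at x l = trans (cong (_! l) (acts x)) (signed-! ρ s id x l)
  value : ∀ x l → R i j (g x) ! l ≡ flip (s′ l) (x ! ρ′ l)
  value x l with l ≟ i | l ≟ j
  ... | yes refl | _ = trans (R-on₁ i≢j (g x)) (trans (cong opposite (g-at x j)) (trans (sym (flip-not (s j) (x ! ρ j)))
    (cong₂ (λ b m → flip b (x ! m)) (sym s′ᵢ) (sym ρ′ᵢ))))
  ... | no _ | yes refl = trans (R-on₂ i j (g x)) (trans (g-at x i) (cong₂ (λ b m → flip b (x ! m)) (sym s′ⱼ) (sym ρ′ⱼ)))
  ... | no l≢i | no l≢j = trans (R-off l≢i l≢j (g x)) (trans (g-at x l)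
    (cong₂ (λ b m → flip b (x ! m)) (sym (s-off l l≢i l≢j)) (sym (ρ-off l l≢i l≢j))))

swap : Fin k → Fin k → (Fin k → A) → Fin k → A
swap i j f = updateAt (updateAt f i (const (f j))) j (const (f i))

swap-swapped : {i j : Fin k} → i ≢ j → (f : Fin k → A) → Swapped i j f (swap i j f)
swap-swapped {i = i} {j} i≢j f = swapped
  (trans (updateAt-minimal i j _ i≢j) (updateAt-updates i f)) (updateAt-updates j _)
  λ l l≢i l≢j → trans (updateAt-minimal l j _ l≢j) (updateAt-minimal l i f l≢i)

rotate : Fin d → Fin d → (Fin d → Bool) → Fin d → Bool
rotate i j s = updateAt (updateAt s i (const (not (s j)))) j (const (s i))

rotate-rotated : {i j : Fin d} → i ≢ j → ∀ s → Rotated i j s (rotate i j s)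
rotate-rotated {i = i} {j} i≢j s = rotated
  (trans (updateAt-minimal i j _ i≢j) (updateAt-updates i s)) (updateAt-updates j _)
  λ l l≢i l≢j → trans (updateAt-minimal l j _ l≢j) (updateAt-minimal l i s l≢i)

rotation-reached : {g : Map n d} → InR n d g → ∃₂ λ ρ s → Reached n g ρ s
rotation-reached R-id = id , const false , reached-id
rotation-reached (R-step i j i≢j g g∈R) with rotation-reached g∈R
... | ρ , s , r = swap i j ρ , rotate i j s , reached-step i≢j r (swap-swapped i≢j ρ) (rotate-rotated i≢j s)

-- R_ij² negates coordinates i and j.
reached-negate : ∀ {g : Map n d} {ρ s i j} → i ≢ j → Reached n g ρ s →
  ∃₂ λ g′ s′ → s′ j ≡ not (s j) × (∀ l → l ≢ i → l ≢ j → s′ l ≡ s l) × Reached n g′ ρ s′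
reached-negate {d = d} {g} {ρ} {s} {i} {j} i≢j r =
  R i j ∘ R i j ∘ g , rotate i j s₁ , trans (Rotated.atⱼ rot₂) (Rotated.atᵢ rot₁) ,
  (λ l l≢i l≢j → trans (Rotated.off rot₂ l l≢i l≢j) (Rotated.off rot₁ l l≢i l≢j)) ,
  reached-step i≢j (reached-step i≢j r sw rot₁)
    (swapped (sym (Swapped.atⱼ sw)) (sym (Swapped.atᵢ sw)) λ l l≢i l≢j → sym (Swapped.off sw l l≢i l≢j)) rot₂
  where
  s₁ : Fin d → Bool
  s₁ = rotate i j s
  sw = swap-swapped i≢j ρ
  rot₁ = rotate-rotated i≢j s
  rot₂ = rotate-rotated i≢j s₁

-- Coordinate 0 is left out: it is the partner in sign corrections, and in the end its entry and
-- sign are forced by injectivity and the determinant.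
AgreeBelow : ℕ → (ρ ρ′ : Fin (suc d) → Fin (suc d)) → (s s′ : Fin (suc d) → Bool) → Set
AgreeBelow m ρ ρ′ s s′ = ∀ l → toℕ l < m → ρ′ (suc l) ≡ ρ (suc l) × s′ (suc l) ≡ s (suc l)

ReachedUpTo : ∀ n → (Fin (suc d) → Fin (suc d)) → (Fin (suc d) → Bool) → ℕ → Set
ReachedUpTo n ρ s m = ∃[ g ] ∃₂ λ ρ′ s′ → Reached n g ρ′ s′ × AgreeBelow m ρ ρ′ s s′

below≢ : {i l : Fin d} → toℕ l < toℕ i → suc l ≢ suc i
below≢ l<i refl = <-irrefl refl l<i

agree-extend : ∀ {ρ ρ′ : Fin (suc d) → Fin (suc d)} {s s′} {i : Fin d} →
  ρ′ (suc i) ≡ ρ (suc i) → s′ (suc i) ≡ s (suc i) →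
  AgreeBelow (toℕ i) ρ ρ′ s s′ → AgreeBelow (suc (toℕ i)) ρ ρ′ s s′
agree-extend {i = i} ρᵢ sᵢ agree l (s≤s l≤i) with m≤n⇒m<n∨m≡n l≤i
... | inj₁ l<i = agree l l<i
... | inj₂ l≡i with refl ← toℕ-injective l≡i = ρᵢ , sᵢ

-- One rotation brings the wanted entry from position `l` to `suc i`. Since `ρ` is injective, `l` is
-- none of the positions already settled.
reach-place : ∀ {ρ : Fin (suc d) → Fin (suc d)} {s} → Inj ρ → (i : Fin d) →
  ∀ {g ρ₀ s₀} → Reached n g ρ₀ s₀ → AgreeBelow (toℕ i) ρ ρ₀ s s₀ → (l : Fin (suc d)) → ρ₀ l ≡ ρ (suc i) → Dec (suc i ≡ l) →
  ∃[ g ] ∃₂ λ ρ′ s′ → Reached n g ρ′ s′ × ρ′ (suc i) ≡ ρ (suc i) × AgreeBelow (toℕ i) ρ ρ′ s s′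
reach-place ρ-inj i {g₀} {ρ₀} {s₀} r₀ agree₀ l ρ₀l (yes refl) = g₀ , ρ₀ , s₀ , r₀ , ρ₀l , agree₀
reach-place ρ-inj i {g₀} {ρ₀} {s₀} r₀ agree₀ l ρ₀l (no i≢l) =
  R (suc i) l ∘ g₀ , swap (suc i) l ρ₀ , rotate (suc i) l s₀ ,
  reached-step i≢l r₀ sw rot , trans (Swapped.atᵢ sw) ρ₀l ,
  λ t t<i → trans (Swapped.off sw (suc t) (below≢ t<i) (t≢l t t<i)) (proj₁ (agree₀ t t<i)) ,
            trans (Rotated.off rot (suc t) (below≢ t<i) (t≢l t t<i)) (proj₂ (agree₀ t t<i))
  where
  sw : Swapped (suc i) l ρ₀ (swap (suc i) l ρ₀)
  sw = swap-swapped i≢l ρ₀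
  rot : Rotated (suc i) l s₀ (rotate (suc i) l s₀)
  rot = rotate-rotated i≢l s₀
  t≢l : ∀ t → toℕ t < toℕ i → suc t ≢ l
  t≢l t t<i eq = below≢ t<i (ρ-inj (trans (sym (proj₁ (agree₀ t t<i))) (trans (cong ρ₀ eq) ρ₀l)))

-- A wrong sign at `suc i` is mended by negating coordinates 0 and `suc i` together.
reach-correct : ∀ {ρ : Fin (suc d) → Fin (suc d)} {s} (i : Fin d) {g ρ′ s′} →
  Reached n g ρ′ s′ → ρ′ (suc i) ≡ ρ (suc i) → AgreeBelow (toℕ i) ρ ρ′ s s′ →
  ReachedUpTo n ρ s (suc (toℕ i))
reach-correct {ρ = ρ} {s} i {g} {ρ′} {s′} r ρᵢ agree with bit-cases (s′ (suc i)) (s (suc i))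
... | inj₁ same = g , ρ′ , s′ , r , agree-extend {ρ = ρ} {ρ′} {s} {s′} ρᵢ (sym same) agree
... | inj₂ differ =
  let g″ , s″ , s″ᵢ , s″-off , r″ = reached-negate {i = zero} {suc i} (λ ()) r
  in g″ , ρ′ , s″ , r″ , agree-extend {ρ = ρ} {ρ′} {s} {s″} ρᵢ (trans s″ᵢ (sym differ))
    λ l l<i → proj₁ (agree l l<i) , trans (s″-off (suc l) (λ ()) (below≢ l<i)) (proj₂ (agree l l<i))

reach-next : ∀ {ρ : Fin (suc d) → Fin (suc d)} {s} → Inj ρ → (i : Fin d) →
  ReachedUpTo n ρ s (toℕ i) → ReachedUpTo n ρ s (suc (toℕ i))
reach-next {ρ = ρ} {s} ρ-inj i (g₀ , ρ₀ , s₀ , r₀ , agree₀) =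
  let l , ρ₀l = Inj⇒surjective ρ₀ (Reached.injective r₀) (ρ (suc i))
      g , ρ′ , s′ , r , ρᵢ , agree = reach-place {ρ = ρ} {s} ρ-inj i r₀ agree₀ l ρ₀l (suc i ≟ l)
  in reach-correct {ρ = ρ} {s} i r ρᵢ agree

reach-all : ∀ {ρ : Fin (suc d) → Fin (suc d)} → Inj ρ → ∀ s m → m ≤ d → ReachedUpTo n ρ s m
reach-all ρ-inj s zero _ = id , id , const false , reached-id , λ l ()
reach-all {d} {n} {ρ} ρ-inj s (suc m) m<d =
  subst (ReachedUpTo n ρ s ∘ suc) (toℕ-fromℕ< m<d) (reach-next {s = s} ρ-inj (fromℕ< m<d)
    (subst (ReachedUpTo n ρ s) (sym (toℕ-fromℕ< m<d)) (reach-all ρ-inj s m (<⇒≤ m<d))))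

-- A rotation is recorded by a signed permutation in which the sign at 0 is forgotten:
-- the determinant recovers it.
Records : ∀ n → Signs (suc d) → Map n (suc d) → Set
Records {d} n (ρ , s) σ = ∃₂ λ ρ′ s′ → ρ′ ≗ ρ × (∀ l → s′ (suc l) ≡ s (suc l)) ×
  det ρ′ s′ ≡ det₀ (suc d) × σ ≗ signed ρ′ s′ id

record-rotation : ∀ (w : Signs (suc d)) → PositiveAt₀ w → ∃[ σ ] InR n (suc d) σ × Records n w σ
record-rotation {d} {n} (ρ , s) (ρ-inj , _) with reach-all {n = n} ρ-inj s d ≤-refl
... | g , ρ′ , s′ , reached g∈R ρ′-inj proper acts , agree =
  g , g∈R , ρ′ , s′ , same , (λ l → proj₂ (agree l (toℕ<n l))) , proper , acts
  where
  same : ρ′ ≗ ρ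
  same (suc l) = proj₁ (agree l (toℕ<n l))
  -- All positive positions are settled, so the remaining value `ρ zero` can only sit at position 0.
  same zero with Inj⇒surjective ρ′ ρ′-inj (ρ zero)
  ... | zero , eq = eq
  ... | suc l , eq with () ← ρ-inj (trans (sym (same (suc l))) eq)

rotation-recorded : ∀ {σ : Map n (suc d)} → InR n (suc d) σ → ∃[ w ] PositiveAt₀ w × Records n w σ
rotation-recorded {d = d} σ∈R with rotation-reached σ∈R
... | ρ , s , reached _ ρ-inj proper acts =
  (ρ , positive) , (ρ-inj , refl) , ρ , s , (λ l → refl) , (λ l → refl) , proper , acts
  where
  positive : Fin (suc d) → Bool
  positive zero = false
  positive (suc l) = s (suc l)

size-R : ∀ {r} → Enum _≈ˢ_ (PositiveAt₀ {d}) r → Enum _≗_ (InR (suc (suc n)) (suc d)) r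
size-R {d} {n} = enum-transfer (Records (suc (suc n))) (λ {w} → record-rotation w) rotation-recorded injective functional
  where
  injective : ∀ {w w′ σ σ′} → PositiveAt₀ w → PositiveAt₀ w′ →
    Records (suc (suc n)) w σ → Records (suc (suc n)) w′ σ′ → σ ≗ σ′ → w ≈ˢ w′
  injective {ρ , s} {ρ′ , s′} (_ , s₀) (_ , s′₀) (ρ₁ , s₁ , ρ≗ , s≗ , _ , σ≗) (ρ₂ , s₂ , ρ′≗ , s′≗ , _ , σ′≗) eq =
    (λ l → trans (sym (ρ≗ l)) (trans (signed-unique-ρ {s = s₁} {s₂} {id} {id} id same l) (ρ′≗ l))) , signs
    where
    same : signed ρ₁ s₁ id ≗ signed ρ₂ s₂ id
    same x = trans (sym (σ≗ x)) (trans (eq x) (σ′≗ x))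
    signs : s ≗ s′
    signs zero = trans s₀ (sym s′₀)
    signs (suc l) = trans (sym (s≗ l))
      (trans (signed-unique-s {ρ = ρ₁} {ρ₂} {s₁} {s₂} {id} {id} id (λ _ → refl) same (suc l)) (s′≗ l))
  functional : ∀ {w w′ σ σ′} → Records (suc (suc n)) w σ → Records (suc (suc n)) w′ σ′ → w ≈ˢ w′ → σ ≗ σ′
  functional (ρ₁ , s₁ , ρ≗ , s≗ , det₁ , σ≗) (ρ₂ , s₂ , ρ′≗ , s′≗ , det₂ , σ′≗) (ρ≈ , s≈) x =
    trans (σ≗ x) (trans (signed-cong {π = id} {id} ρ-same s-same (λ _ → refl) x) (sym (σ′≗ x)))
    where
    ρ-same : ρ₁ ≗ ρ₂
    ρ-same l = trans (ρ≗ l) (trans (ρ≈ l) (sym (ρ′≗ l)))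
    s-suc : ∀ l → s₁ (suc l) ≡ s₂ (suc l)
    s-suc l = trans (s≗ l) (trans (s≈ (suc l)) (sym (s′≗ l)))
    sign₀ : ∀ i a b p → i xor (a xor p) ≡ i xor (b xor p) → a ≡ b
    sign₀ i a b p eq = trans (isolate a) (trans (cong (λ v → v xor (i xor p)) eq) (sym (isolate b)))
      where
      isolate : ∀ a → a ≡ (i xor (a xor p)) xor (i xor p)
      isolate a = solve 3 (λ i a p → a := (i :+ (a :+ p)) :+ (i :+ p)) refl i a p
    s-same : s₁ ≗ s₂
    s-same (suc l) = s-suc l
    -- The determinants agree and so do all their other contributions; cancelling these leaves the
    -- sign at 0.
    s-same zero = sign₀ (inversions ρ₂) (s₁ zero) (s₂ zero) (parity (s₂ ∘ suc))
      (trans (sym (cong₂ (λ i p → i xor (s₁ zero xor p)) (inversions-cong ρ-same) (parity-cong s-suc))) (trans det₁ (sym det₂)))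

theorem7 : ∀ (n d : ℕ) → 3 ≤ n → 2 ≤ d →
    ∃[ t ] ∃[ r ] ∃[ f ]
    (HasSize (InT n d) t × HasSize (InR n d) r × HasSize (InF n d) f × t ≡ r * f)
theorem7 (suc (suc (suc n))) (suc (suc d)) (s≤s (s≤s (s≤s z≤n))) (s≤s (s≤s z≤n)) =
  -- One enumeration `signs` counts ℝ_d and also supplies the first factor for the line-preserving
  -- permutations, so no order has to be computed.
  let r , signs = enum-signs {suc d}
      f , symmetric = enum-symmetric {suc (suc (suc n))}
  in r * f , r , f , enum⇒size (size-T signs symmetric) , enum⇒size (size-R signs) , enum⇒size (size-F symmetric) , refl
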